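{- Let $H$ be a graph with at least one edge. Then: (i) if $H$ contains a pendant edge, then $\lim_{n\to \infty} \frac{\mathrm{rwsat}(n, H)}{n}=0$; (ii) if $H$ contains no pendant edge, then $\frac{1}{2}\delta'(H)\leq \lim_{n\to \infty} \frac{\mathrm{rwsat}(n, H)}{n}\leq \delta'(H)$.
   Context: All graphs are finite and simple. An edge is pendant if one of its endpoints has degree $1$. For a graph $H$, $\delta'(H)=\min\{d_H(v)\colon v\in V(H),\ d_H(v)\neq 0\}$. An edge-coloring of a graph $G$ is a map $c\colon E(G)\to\mathbb{N}$; a subgraph is rainbow if its edges receive pairwise distinct colors. For a fixed graph $H$, an edge-colored graph $G$ is called weakly $H$-rainbow saturated if there exists an ordering $e_1,\dots,e_m$ of the non-edges of $G$ such that for every list $c_1,\dots,c_m$ of pairwise distinct colors from $\mathbb{N}$ (which may coincide with colors already used on $G$), for every $i\in[m]$ the edge-colored graph obtained from $G$ by adding $e_1,\dots,e_i$ with $e_k$ colored $c_k$ contains a rainbow copy of $H$ containing the edge $e_i$. ($G$ itself need not be free of rainbow copies of $H$.) $\mathrm{rwsat}(n,H)$ is the minimum number of edges of a weakly $H$-rainbow saturated edge-colored graph on $n$ vertices (defined as $\binom n2$ if none exists). (The limit is known to exist.) -}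

module Defs where

open import Data.Nat using (ℕ; zero; suc; _≤_; _⊓_)
open import Data.Nat.Combinatorics using (_C_)
open import Data.Bool using (Bool; true; false; _∧_; _∨_; if_then_else_; T)
open import Data.Fin using (Fin; _<?_; _<_) renaming (_≟_ to _≟F_)
open import Data.List using (List; []; _∷_; _++_; [_]; length; filter; map; concatMap; allFin; zip)
open import Data.List.Relation.Binary.Permutation.Propositional using (_↭_)
open import Data.List.Relation.Unary.Unique.Propositional using (Unique)
open import Data.Product using (_×_; _,_; Σ; ∃; ∃-syntax)
open import Data.Sum using (_⊎_)
open import Function.Definitions using (Injective)
open import Relation.Binary.PropositionalEquality using (_≡_; _≢_)
open import Relation.Nullary using (¬_)
open import Relation.Nullary.Decidable using (⌊_⌋; T?; ¬?)

Adj : ℕ → Set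
Adj n = Fin n → Fin n → Bool

IsSimpleAdj : ∀ {n} → Adj n → Set
IsSimpleAdj {n} A = (∀ (i j : Fin n) → A i j ≡ A j i) × (∀ (i : Fin n) → A i i ≡ false)

upperPairs : (n : ℕ) → List (Fin n × Fin n)
upperPairs n = filter (λ p → Data.Product.proj₁ p <? Data.Product.proj₂ p)
  (concatMap (λ i → map (λ j → (i , j)) (allFin n)) (allFin n))
  where import Data.Product

edgeList : ∀ {n} → Adj n → List (Fin n × Fin n)
edgeList {n} A = filter (λ p → T? (A (Data.Product.proj₁ p) (Data.Product.proj₂ p))) (upperPairs n)
  where import Data.Product

nonEdgeList : ∀ {n} → Adj n → List (Fin n × Fin n)
nonEdgeList {n} A = filter (λ p → ¬? (T? (A (Data.Product.proj₁ p) (Data.Product.proj₂ p)))) (upperPairs n)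
  where import Data.Product

edgeCount : ∀ {n} → Adj n → ℕ
edgeCount A = length (edgeList A)

deg : ∀ {n} → Adj n → Fin n → ℕ
deg {n} A x = length (filter (λ y → T? (A x y)) (allFin n))

HasEdge : ∀ {n} → Adj n → Set
HasEdge {n} A = ∃[ x ] ∃[ y ] (A x y ≡ true)

HasPendantEdge : ∀ {n} → Adj n → Set
HasPendantEdge {n} A = ∃[ x ] ∃[ y ] (A x y ≡ true × (deg A x ≡ 1 ⊎ deg A y ≡ 1))

-- δ'(H): minimum nonzero degree (0 if H has no edges; not used then)
minList : List ℕ → ℕ
minList [] = 0
minList (d ∷ ds) = go d ds
  where
  go : ℕ → List ℕ → ℕ
  go a [] = a
  go a (b ∷ bs) = go (a ⊓ b) bs

δ′ : ∀ {n} → Adj n → ℕ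
δ′ {n} A = minList (filter (λ d → ¬? (d Data.Nat.≟ 0)) (Data.List.map (deg A) (allFin n)))
  where import Data.Nat

-- Edge-colored graphs: adjacency plus a (symmetric) coloring Fin n → Fin n → ℕ;
-- only the values of the coloring on edges are meaningful.

record CGraph (n : ℕ) : Set where
  constructor cgraph
  field
    adj : Adj n
    col : Fin n → Fin n → ℕ
open CGraph public

IsSimpleCGraph : ∀ {n} → CGraph n → Set
IsSimpleCGraph {n} G = IsSimpleAdj (adj G) × (∀ (i j : Fin n) → col G i j ≡ col G j i)

eqF : ∀ {n} → Fin n → Fin n → Bool
eqF i j = ⌊ i ≟F j ⌋

addEdge : ∀ {n} → CGraph n → (Fin n × Fin n) × ℕ → CGraph n
addEdge G ((a , b) , c) = cgraph
  (λ x y → adj G x y ∨ isAB x y)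
  (λ x y → if isAB x y then c else col G x y)
  where
  isAB : _ → _ → Bool
  isAB x y = (eqF x a ∧ eqF y b) ∨ (eqF x b ∧ eqF y a)

addEdges : ∀ {n} → CGraph n → List ((Fin n × Fin n) × ℕ) → CGraph n
addEdges G [] = G
addEdges G (e ∷ es) = addEdges (addEdge G e) es

RainbowCopyWith : ∀ {h n} → Adj h → CGraph n → Fin n × Fin n → Set
RainbowCopyWith {h} {n} H G (a , b) =
  ∃[ φ ] (Injective _≡_ _≡_ φ
    × (∀ (x y : Fin h) → H x y ≡ true → adj G (φ x) (φ y) ≡ true)
    × (∀ (x y x′ y′ : Fin h) → H x y ≡ true → H x′ y′ ≡ true → x < y → x′ < y′
         → (x , y) ≢ (x′ , y′) → col G (φ x) (φ y) ≢ col G (φ x′) (φ y′))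
    × (∃[ x ] ∃[ y ] (H x y ≡ true × φ x ≡ a × φ y ≡ b)))

WeaklyRainbowSat : ∀ {h n} → Adj h → CGraph n → Set
WeaklyRainbowSat {h} {n} H G =
  ∃[ es ] (es ↭ nonEdgeList (adj G)
    × ((cs : List ℕ) → Unique cs → length cs ≡ length es →
        ∀ (pre post : List ((Fin n × Fin n) × ℕ)) (e : Fin n × Fin n) (c : ℕ) →
        zip es cs ≡ pre ++ (e , c) ∷ post →
        RainbowCopyWith H (addEdges G (pre ++ [ (e , c) ])) e))

IsRwsat : ∀ {h} → Adj h → ℕ → ℕ → Set
IsRwsat {h} H n k =
  (∃[ G ] (IsSimpleCGraph {n} G × WeaklyRainbowSat H G × edgeCount (adj G) ≡ k
     × (∀ (G′ : CGraph n) → IsSimpleCGraph G′ → WeaklyRainbowSat H G′ → k ≤ edgeCount (adj G′))))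
  ⊎ ((∀ (G : CGraph n) → IsSimpleCGraph G → ¬ WeaklyRainbowSat H G) × k ≡ n C 2)

{-# OPTIONS --safe #-}

-- Write δ for δ′(H).
--
-- Lower bound (no pendant edge, so δ ≥ 2).  In a weakly rainbow saturated G consider the first new edge at a
-- vertex v and give it the colour of an edge that v already has in G.  The copy of H it completes cannot use
-- that old edge, so v has at least δ further edges, one of them new: deg v ≥ δ, and G has at least δ n / 2 edges.
--
-- Upper bound.  Take a clique of constant size, join s of its vertices to everything (s = 0 if H has a leaf,
-- s = δ otherwise), and colour all edges differently.  First add the missing edges between the clique and
-- the outside: the colour of the new edge u v occurs on at most one old edge, which has an end z other than u
-- and v; avoiding z, map a vertex of minimum degree to v and the rest of H to the clique.  Then add the edges
-- between outside vertices v and v′: each edge from {v, v′} to the clique clashes with at most one clique edge,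
-- so a large clique contains an independent set of this sparse conflict graph, which hosts the rest of H.

module Submission where

open import Defs
import Data.Bool as 𝔹
open import Data.Bool using (Bool; true; false; _∧_; _∨_; if_then_else_; T)
open import Data.Bool.Properties using (∨-zeroʳ; ∨-comm; ∧-comm)
open import Data.Empty using (⊥-elim)
open import Data.Fin as F using (Fin; toℕ; fromℕ<; combine) renaming (_≟_ to _≟F_)
open import Data.Fin.Properties using (<-cmp; any?; injective⇒≤; toℕ-fromℕ<; toℕ<n; toℕ-injective; combine-injective)
open import Data.List using (List; []; _∷_; _++_; [_]; length; filter; map; concatMap; allFin; zip; take; drop; tabulate; cartesianProduct; applyUpTo; lookup)
open import Data.List.Properties using (length-map; length-++; length-take; length-drop; length-tabulate; length-filter; length-applyUpTo; filter-++; map-++; take++drop≡id; ∷-injective)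
open import Data.List.Membership.Propositional using (_∈_; _∉_)
open import Data.List.Membership.Propositional.Properties
import Data.List.Membership.DecPropositional as DecMem
open import Data.List.Relation.Binary.Permutation.Propositional using (_↭_; prep; ↭-refl; ↭-trans; ↭-sym)
open import Data.List.Relation.Binary.Permutation.Propositional.Properties using (shift; ∈-resp-↭)
open import Data.List.Relation.Binary.Pointwise as PW using (Pointwise; []; _∷_)
open import Data.List.Relation.Binary.Subset.Propositional using (_⊆_)
open import Data.List.Relation.Unary.All as All using (All; []; _∷_)
open import Data.List.Relation.Unary.AllPairs using ([]; _∷_)
open import Data.List.Relation.Unary.Any as Any using (here; there; index)
open import Data.List.Relation.Unary.Any.Properties using (lookup-index)
open import Data.List.Relation.Unary.Unique.Propositional using (Unique)
import Data.List.Relation.Unary.Unique.Propositional.Properties as Uniq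
open import Data.Nat using (ℕ; zero; suc; _≤_; _<_; _*_; _+_; _∸_; _⊓_; z≤n; s≤s)
import Data.Nat as ℕ
open import Data.Nat.Properties hiding (_≟_; <-cmp)
open import Data.Nat.Tactic.RingSolver using (solve-∀)
open import Data.Product using (_×_; _,_; ∃-syntax; proj₁; proj₂; uncurry; swap)
open import Data.Sum using (_⊎_; inj₁; inj₂)
open import Data.Unit using (tt)
open import Function using (_∘_; id; case_of_; mk⇔)
open import Function.Definitions using (Injective)
open import Level using (Level)
open import Relation.Binary.Definitions using (tri<; tri≈; tri>)
open import Relation.Binary.PropositionalEquality using (_≡_; _≢_; refl; sym; trans; cong; cong₂; subst)
open import Relation.Nullary using (¬_; Dec; yes; no; does; contradiction)
open import Relation.Nullary.Decidable using (¬?; T?; _×-dec_; _⊎-dec_; does-⇔; dec-true; dec-false; decidable-stable)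
open import Relation.Unary using (Pred; Decidable)

private
  variable
    a : Level
    A B : Set a
    n h : ℕ

-- Lists without repetition as finite sets

lookup-injective : {xs : List A} → Unique xs → Injective _≡_ _≡_ (lookup xs)
lookup-injective {xs = x ∷ xs} (p ∷ u) {Fin.zero} {Fin.zero} eq = refl
lookup-injective {xs = x ∷ xs} (p ∷ u) {Fin.zero} {Fin.suc j} eq =
  contradiction eq (All.lookup p (∈-lookup j))
lookup-injective {xs = x ∷ xs} (p ∷ u) {Fin.suc i} {Fin.zero} eq =
  contradiction (sym eq) (All.lookup p (∈-lookup i))
lookup-injective {xs = x ∷ xs} (p ∷ u) {Fin.suc i} {Fin.suc j} eq =
  cong Fin.suc (lookup-injective u eq)

-- Sending a position in `xs` to a position of the same element in `ys` is injective. Most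
-- cardinality estimates below reduce to this one.
unique-⊆⇒length≤ : {xs ys : List A} → Unique xs → xs ⊆ ys → length xs ≤ length ys
unique-⊆⇒length≤ {xs = xs} {ys} u sub = injective⇒≤ {f = f} f-inj
  where
  f : Fin (length xs) → Fin (length ys)
  f i = index (sub (∈-lookup i))
  f-inj : Injective _≡_ _≡_ f
  f-inj {i} {j} eq = lookup-injective u
    (trans (lookup-index (sub (∈-lookup i)))
      (trans (cong (lookup ys) eq) (sym (lookup-index (sub (∈-lookup j))))))

infixl 6 _∖_
_∖_ : List (Fin n) → List (Fin n) → List (Fin n)
xs ∖ ys = filter (λ x → ¬? (x ∈? ys)) xs
  where open DecMem _≟F_ using (_∈?_)

module _ {n : ℕ} where
  open DecMem {A = Fin n} _≟F_ using (_∈?_)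

  ∈-∖⁻ : {x : Fin n} (xs ys : List (Fin n)) → x ∈ xs ∖ ys → x ∈ xs × x ∉ ys
  ∈-∖⁻ xs ys = ∈-filter⁻ (λ x → ¬? (x ∈? ys)) {xs = xs}

  ∈-∖⁺ : {x : Fin n} {xs ys : List (Fin n)} → x ∈ xs → x ∉ ys → x ∈ xs ∖ ys
  ∈-∖⁺ {ys = ys} = ∈-filter⁺ (λ x → ¬? (x ∈? ys))

  ∖-unique : {xs : List (Fin n)} (ys : List (Fin n)) → Unique xs → Unique (xs ∖ ys)
  ∖-unique ys = Uniq.filter⁺ (λ x → ¬? (x ∈? ys))

  length-∖ : {xs : List (Fin n)} (ys : List (Fin n)) → Unique xs →
             length xs ≤ length (xs ∖ ys) + length ys
  length-∖ {xs} ys u = subst (length xs ≤_) (length-++ (xs ∖ ys)) (unique-⊆⇒length≤ u sub)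
    where
    sub : xs ⊆ (xs ∖ ys) ++ ys
    sub {x} x∈ with x ∈? ys
    ... | yes p = ∈-++⁺ʳ (xs ∖ ys) p
    ... | no ¬p = ∈-++⁺ˡ (∈-∖⁺ x∈ ¬p)

  fresh : {xs ys : List (Fin n)} → Unique xs → length ys < length xs → ∃[ x ] (x ∈ xs × x ∉ ys)
  fresh {xs} {ys} u lt with xs ∖ ys in eq
  ... | x ∷ _ = x , ∈-∖⁻ xs ys (subst (x ∈_) (sym eq) (here refl))
  ... | [] = contradiction
    (≤-trans lt (subst (λ l → length xs ≤ length l + length ys) eq (length-∖ ys u))) 1+n≰n

-- Injections given by parallel lists

module _ {R : A → B → Set} where

  image : ∀ {xs ys} → Pointwise R xs ys → ∀ {x} → x ∈ xs → B
  image {ys = y ∷ _} (_ ∷ rs) (here _) = y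
  image (_ ∷ rs) (there p) = image rs p

  image-∈ : ∀ {xs ys} (rs : Pointwise R xs ys) {x} (p : x ∈ xs) → image rs p ∈ ys
  image-∈ (_ ∷ rs) (here _) = here refl
  image-∈ (_ ∷ rs) (there p) = there (image-∈ rs p)

  image-rel : ∀ {xs ys} (rs : Pointwise R xs ys) {x} (p : x ∈ xs) → R x (image rs p)
  image-rel (r ∷ rs) (here refl) = r
  image-rel (_ ∷ rs) (there p) = image-rel rs p

  image-injective : ∀ {xs ys} (rs : Pointwise R xs ys) → Unique ys →
    ∀ {x x′} (p : x ∈ xs) (q : x′ ∈ xs) → image rs p ≡ image rs q → x ≡ x′
  image-injective (_ ∷ rs) u (here refl) (here refl) eq = refl
  image-injective (_ ∷ rs) (y∉ ∷ u) (here _) (there q) eq =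
    contradiction eq (All.lookup y∉ (image-∈ rs q))
  image-injective (_ ∷ rs) (y∉ ∷ u) (there p) (here _) eq =
    contradiction (sym eq) (All.lookup y∉ (image-∈ rs p))
  image-injective (_ ∷ rs) (_ ∷ u) (there p) (there q) eq = image-injective rs u p q eq

  -- This is how copies of `H` are specified: `xs` lists the vertices of `H`, `ys` their targets,
  -- and `R` records what is required of each placement. Equal images occupy one position of the
  -- repetition-free list `ys`, hence come from one entry of `xs`.
  pointwise⇒injection : ∀ {xs ys} → Pointwise R xs ys → Unique ys → (∀ x → x ∈ xs) →
    ∃[ φ ] (Injective _≡_ _≡_ φ × (∀ x → R x (φ x)))
  pointwise⇒injection rs u cover =
    (λ x → image rs (cover x)) , image-injective rs u (cover _) (cover _) , λ x → image-rel rs (cover x)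

-- Any large enough supply `ys` of targets will do. The matching remembers only the two lists its
-- entries come from, which is all that later placements use.
truncate : (xs : List A) (ys : List B) → length xs ≤ length ys → Unique ys →
  ∃[ zs ] (Pointwise (λ x y → x ∈ xs × y ∈ ys) xs zs × Unique zs × zs ⊆ ys)
truncate [] ys _ _ = [] , [] , [] , λ ()
truncate (x ∷ xs) (y ∷ ys) (s≤s le) (y∉ ∷ u) with truncate xs ys le u
... | zs , pw , uz , sub =
  y ∷ zs ,
  (here refl , here refl) ∷ PW.map (λ (p , q) → there p , there q) pw ,
  All.tabulate (λ z∈ → All.lookup y∉ (sub z∈)) ∷ uz ,
  λ { (here e) → here e ; (there z∈) → there (sub z∈) }

-- Independent sets in digraphs of bounded out-degree

∈-take : ∀ k (xs : List A) {x} → x ∈ take k xs → x ∈ xs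
∈-take k xs p = subst (_ ∈_) (take++drop≡id k xs) (∈-++⁺ˡ p)

∈-drop : ∀ k (xs : List A) {x} → x ∈ drop k xs → x ∈ xs
∈-drop k xs p = subst (_ ∈_) (take++drop≡id k xs) (∈-++⁺ʳ (take k xs) p)

take-drop-disjoint : ∀ k {xs : List A} → Unique xs → ∀ {x y} → x ∈ take k xs → y ∈ drop k xs → x ≢ y
take-drop-disjoint (suc k) {x ∷ xs} (x∉ ∷ u) (here refl) q = All.lookup x∉ (∈-drop k xs q)
take-drop-disjoint (suc k) {x ∷ xs} (x∉ ∷ u) (there p) q = take-drop-disjoint k u p q

length-concatMap : ∀ (f : A → List B) d → (∀ x → length (f x) ≤ d) →
  ∀ xs → length (concatMap f xs) ≤ length xs * d
length-concatMap f d b [] = z≤n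
length-concatMap f d b (x ∷ xs) = subst (_≤ d + length xs * d) (sym (length-++ (f x)))
  (+-mono-≤ (b x) (length-concatMap f d b xs))

-- How many vertices guarantee k pairwise non-adjacent ones in a digraph of out-degree at most d.
indepBound : ℕ → ℕ → ℕ
indepBound d zero = 0
indepBound d (suc k) = (indepBound d k + d) + suc ((indepBound d k + d) * d)

module _ {n : ℕ} (out : Fin n → List (Fin n)) (d : ℕ) (bounded : ∀ w → length (out w) ≤ d) where

  -- Reserve m = indepBound d k + d vertices; among the remaining ones (more than m * d) some w is
  -- no out-neighbour of a reserved vertex.  Discard the out-neighbours of w and recurse on the rest.
  independentSet : ∀ k {xs : List (Fin n)} → Unique xs → indepBound d k ≤ length xs →
    ∃[ S ] (length S ≡ k × Unique S × S ⊆ xs × (∀ {x y} → x ∈ S → y ∈ S → x ≢ y → y ∉ out x))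
  independentSet zero _ _ = [] , refl , [] , (λ ()) , λ ()
  independentSet (suc k) {xs} u le
    with fresh {xs = drop m xs} {concatMap out (take m xs)} (Uniq.drop⁺ m u) many
    where
    m = indepBound d k + d
    len-take : length (take m xs) ≡ m
    len-take = trans (length-take m xs) (m≤n⇒m⊓n≡m (≤-trans (m≤m+n m _) le))
    many : length (concatMap out (take m xs)) < length (drop m xs)
    many = begin-strict
      length (concatMap out (take m xs)) ≤⟨ length-concatMap out d bounded (take m xs) ⟩
      length (take m xs) * d             ≡⟨ cong (_* d) len-take ⟩
      m * d                              <⟨ n<1+n _ ⟩
      suc (m * d)                        ≡⟨ sym (m+n∸m≡n m _) ⟩
      (m + suc (m * d)) ∸ m              ≤⟨ ∸-monoˡ-≤ m le ⟩
      length xs ∸ m                      ≡⟨ sym (length-drop m xs) ⟩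
      length (drop m xs) ∎
      where open ≤-Reasoning
  ... | w , w∈ , w∉ with independentSet k {take m xs ∖ out w} (∖-unique (out w) (Uniq.take⁺ m u)) enough
    where
    m = indepBound d k + d
    enough : indepBound d k ≤ length (take m xs ∖ out w)
    enough = +-cancelʳ-≤ d _ _ (begin
      m                                            ≡⟨ sym (m≤n⇒m⊓n≡m (≤-trans (m≤m+n m _) le)) ⟩
      m ⊓ length xs                                ≡⟨ sym (length-take m xs) ⟩
      length (take m xs)                           ≤⟨ length-∖ (out w) (Uniq.take⁺ m u) ⟩
      length (take m xs ∖ out w) + length (out w)  ≤⟨ +-monoʳ-≤ _ (bounded w) ⟩
      length (take m xs ∖ out w) + d ∎)
      where open ≤-Reasoning
  ... | S , len , uS , sub , ind =
    w ∷ S , cong suc len ,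
    All.tabulate (λ s∈ w≡s → take-drop-disjoint m u (inTake s∈) w∈ (sym w≡s)) ∷ uS ,
    (λ { (here refl) → ∈-drop m xs w∈ ; (there s∈) → ∈-take m xs (inTake s∈) }) ,
    indep
    where
    m = indepBound d k + d
    inTake : ∀ {s} → s ∈ S → s ∈ take m xs
    inTake s∈ = proj₁ (∈-∖⁻ (take m xs) (out w) (sub s∈))
    indep : ∀ {x y} → x ∈ w ∷ S → y ∈ w ∷ S → x ≢ y → y ∉ out x
    indep (here refl) (here refl) x≢y = contradiction refl x≢y
    indep (here refl) (there y∈) _ = proj₂ (∈-∖⁻ (take m xs) (out w) (sub y∈))
    -- `x` is a reserved vertex, and `w` was chosen outside the out-neighbourhoods of all reserved
    -- vertices.
    indep {x} (there x∈) (here refl) _ w∈out =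
      w∉ (∈-concatMap⁺ out (Any.map (λ { refl → w∈out }) (inTake x∈)))
    indep (there x∈) (there y∈) = ind x∈ y∈

-- Intervals of vertices

block : ∀ a k → a + k ≤ n → List (Fin n)
block a k le = tabulate {n = k} (λ i → fromℕ< (<-≤-trans (+-monoʳ-< a (toℕ<n i)) le))

module _ (a k : ℕ) (le : a + k ≤ n) where

  ∈-block : ∀ {i} → i ∈ block a k le → a ≤ toℕ i × toℕ i < a + k
  ∈-block i∈ with ∈-tabulate⁻ i∈
  ... | j , refl = subst (λ t → a ≤ t × t < a + k) (sym (toℕ-fromℕ< _))
                     (m≤m+n a (toℕ j) , +-monoʳ-< a (toℕ<n j))

  block-unique : Unique (block a k le)
  block-unique = Uniq.tabulate⁺ λ {i} {j} eq → toℕ-injective (+-cancelˡ-≡ a _ _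
    (trans (sym (toℕ-fromℕ< _)) (trans (cong toℕ eq) (toℕ-fromℕ< _))))

  length-block : length (block a k le) ≡ k
  length-block = length-tabulate _

  ∈-block⁺ : ∀ {i} → a ≤ toℕ i → toℕ i < a + k → i ∈ block a k le
  ∈-block⁺ {i} a≤ lt = subst (_∈ block a k le) (toℕ-injective eq) (∈-tabulate⁺ j)
    where
    i∸a<k : toℕ i ∸ a < k
    i∸a<k = +-cancelˡ-< a _ _ (subst (_< a + k) (sym (m+[n∸m]≡n a≤)) lt)
    j = fromℕ< i∸a<k
    eq : toℕ (fromℕ< (<-≤-trans (+-monoʳ-< a (toℕ<n j)) le)) ≡ toℕ i
    eq = trans (toℕ-fromℕ< _) (trans (cong (a +_) (toℕ-fromℕ< i∸a<k)) (m+[n∸m]≡n a≤))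

-- Permits an order of the non-edges in two phases, those satisfying `P?` coming first.
filter-split-↭ : {P : Pred A Level.zero} (P? : Decidable P) (xs : List A) →
  filter P? xs ++ filter (¬? ∘ P?) xs ↭ xs
filter-split-↭ P? [] = ↭-refl
filter-split-↭ P? (x ∷ xs) with P? x
... | yes _ = prep x (filter-split-↭ P? xs)
... | no _ = ↭-trans (shift x (filter P? xs) _) (prep x (filter-split-↭ P? xs))

-- Neighbourhoods and edge lists

true⇒T : ∀ {b} → b ≡ true → T b
true⇒T refl = tt

T⇒true : ∀ {b} → T b → b ≡ true
T⇒true {true} _ = refl

neighbours : Adj n → Fin n → List (Fin n)
neighbours A x = filter (λ y → T? (A x y)) (allFin _)

∈-neighbours⁺ : (A : Adj n) {x y : Fin n} → A x y ≡ true → y ∈ neighbours A x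
∈-neighbours⁺ A {x} eq = ∈-filter⁺ (λ y → T? (A x y)) (∈-allFin _) (true⇒T eq)

∈-neighbours⁻ : (A : Adj n) {x y : Fin n} → y ∈ neighbours A x → A x y ≡ true
∈-neighbours⁻ {n} A {x} y∈ = T⇒true (proj₂ (∈-filter⁻ (λ y → T? (A x y)) {xs = allFin n} y∈))

neighbours-unique : (A : Adj n) (x : Fin n) → Unique (neighbours A x)
neighbours-unique {n} A x = Uniq.filter⁺ (λ y → T? (A x y)) (Uniq.allFin⁺ n)

-- Makes the library facts on `cartesianProduct` available for `upperPairs`.
concatMap≡cartesianProduct : ∀ (xs : List A) (ys : List B) →
  concatMap (λ i → map (λ j → (i , j)) ys) xs ≡ cartesianProduct xs ys
concatMap≡cartesianProduct [] ys = refl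
concatMap≡cartesianProduct (x ∷ xs) ys = cong (map (x ,_) ys ++_) (concatMap≡cartesianProduct xs ys)

∈-upperPairs⁺ : {i j : Fin n} → i F.< j → (i , j) ∈ upperPairs n
∈-upperPairs⁺ {n} {i} {j} i<j = ∈-filter⁺ (λ p → proj₁ p F.<? proj₂ p)
  (subst ((i , j) ∈_) (sym (concatMap≡cartesianProduct (allFin n) (allFin n)))
    (∈-cartesianProduct⁺ (∈-allFin i) (∈-allFin j))) i<j

∈-upperPairs⁻ : {p : Fin n × Fin n} → p ∈ upperPairs n → proj₁ p F.< proj₂ p
∈-upperPairs⁻ {n} p∈ = proj₂ (∈-filter⁻ (λ p → proj₁ p F.<? proj₂ p)
  {xs = concatMap (λ i → map (λ j → (i , j)) (allFin n)) (allFin n)} p∈)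

upperPairs-unique : ∀ n → Unique (upperPairs n)
upperPairs-unique n = Uniq.filter⁺ (λ p → proj₁ p F.<? proj₂ p)
  (subst Unique (sym (concatMap≡cartesianProduct (allFin n) (allFin n)))
    (Uniq.cartesianProduct⁺ (Uniq.allFin⁺ n) (Uniq.allFin⁺ n)))

∈-edgeList⁺ : (A : Adj n) {i j : Fin n} → i F.< j → A i j ≡ true → (i , j) ∈ edgeList A
∈-edgeList⁺ A i<j eq = ∈-filter⁺ (λ p → T? (A (proj₁ p) (proj₂ p))) (∈-upperPairs⁺ i<j) (true⇒T eq)

∈-nonEdgeList⁺ : (A : Adj n) {i j : Fin n} → i F.< j → A i j ≢ true → (i , j) ∈ nonEdgeList A
∈-nonEdgeList⁺ A i<j neq = ∈-filter⁺ (λ p → ¬? (T? (A (proj₁ p) (proj₂ p)))) (∈-upperPairs⁺ i<j) (neq ∘ T⇒true)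

∈-nonEdgeList⁻ : (A : Adj n) {p : Fin n × Fin n} → p ∈ nonEdgeList A →
  proj₁ p F.< proj₂ p × A (proj₁ p) (proj₂ p) ≢ true
∈-nonEdgeList⁻ {n} A p∈ with ∈-filter⁻ (λ p → ¬? (T? (A (proj₁ p) (proj₂ p)))) {xs = upperPairs n} p∈
... | p∈u , ¬t = ∈-upperPairs⁻ p∈u , ¬t ∘ true⇒T

-- Unordered pairs

Same : (i j a b : Fin n) → Set
Same i j a b = (i ≡ a × j ≡ b) ⊎ (i ≡ b × j ≡ a)

same? : (i j a b : Fin n) → Dec (Same i j a b)
same? i j a b = ((i ≟F a) ×-dec (j ≟F b)) ⊎-dec ((i ≟F b) ×-dec (j ≟F a))

same-swap : {i j a b : Fin n} → Same i j a b → Same j i a b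
same-swap (inj₁ (p , q)) = inj₂ (q , p)
same-swap (inj₂ (p , q)) = inj₁ (q , p)

same-sym : {i j a b : Fin n} → Same i j a b → Same a b i j
same-sym (inj₁ (refl , refl)) = inj₁ (refl , refl)
same-sym (inj₂ (refl , refl)) = inj₂ (refl , refl)

same-trans : {i j a b c d : Fin n} → Same i j a b → Same a b c d → Same i j c d
same-trans (inj₁ (refl , refl)) s = s
same-trans (inj₂ (refl , refl)) s = same-swap s

same-other : {v s t a b : Fin n} → Same v s a b → Same v t a b → s ≡ t
same-other (inj₁ (refl , refl)) (inj₁ (refl , refl)) = refl
same-other (inj₁ (refl , refl)) (inj₂ (refl , refl)) = refl
same-other (inj₂ (refl , refl)) (inj₁ (refl , refl)) = refl
same-other (inj₂ (refl , refl)) (inj₂ (refl , refl)) = refl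

-- A copy of the local test inside `addEdge`, so that facts about `Same` transfer to `addEdges` by
-- computation.
sameᵇ : (x y a b : Fin n) → Bool
sameᵇ x y a b = (eqF x a ∧ eqF y b) ∨ (eqF x b ∧ eqF y a)

eqF-refl : (x : Fin n) → eqF x x ≡ true
eqF-refl x with x ≟F x
... | yes _ = refl
... | no ¬p = contradiction refl ¬p

eqF⇒≡ : (x y : Fin n) → eqF x y ≡ true → x ≡ y
eqF⇒≡ x y eq with x ≟F y
... | yes p = p
eqF⇒≡ x y () | no _

sameᵇ⁺ : {x y a b : Fin n} → Same x y a b → sameᵇ x y a b ≡ true
sameᵇ⁺ {x = x} {y} (inj₁ (refl , refl)) rewrite eqF-refl x | eqF-refl y = refl
sameᵇ⁺ {x = x} {y} (inj₂ (refl , refl)) rewrite eqF-refl x | eqF-refl y = ∨-zeroʳ _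

sameᵇ⁻ : (x y a b : Fin n) → sameᵇ x y a b ≡ true → Same x y a b
sameᵇ⁻ x y a b eq with eqF x a in p | eqF y b in q | eqF x b in r | eqF y a in s
... | true | true | _ | _ = inj₁ (eqF⇒≡ x a p , eqF⇒≡ y b q)
... | _ | _ | true | true = inj₂ (eqF⇒≡ x b r , eqF⇒≡ y a s)
sameᵇ⁻ x y a b () | false | _ | false | _
sameᵇ⁻ x y a b () | false | _ | true | false
sameᵇ⁻ x y a b () | true | false | false | _
sameᵇ⁻ x y a b () | true | false | true | false

sameᵇ-false : {x y a b : Fin n} → ¬ Same x y a b → sameᵇ x y a b ≡ false
sameᵇ-false {x = x} {y} {a} {b} ¬s with sameᵇ x y a b in eq
... | true = contradiction (sameᵇ⁻ x y a b eq) ¬s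
... | false = refl

-- Adding coloured edges

Entry : ℕ → Set
Entry n = (Fin n × Fin n) × ℕ

Matches : Fin n → Fin n → Entry n → Set
Matches i j ((a , b) , _) = Same i j a b

Covered Uncovered : List (Entry n) → Fin n → Fin n → Set
Covered ps i j = ∃[ e ] (e ∈ ps × Matches i j e)
Uncovered ps i j = ∀ {e} → e ∈ ps → ¬ Matches i j e

addEdges-adj⁺ : (ps : List (Entry n)) (G : CGraph n) {i j : Fin n} →
  adj G i j ≡ true → adj (addEdges G ps) i j ≡ true
addEdges-adj⁺ [] G eq = eq
addEdges-adj⁺ (((a , b) , c) ∷ ps) G {i} {j} eq =
  addEdges-adj⁺ ps _ (cong (_∨ sameᵇ i j a b) eq)

addEdges-adj-new : (ps : List (Entry n)) (G : CGraph n) {i j : Fin n} →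
  Covered ps i j → adj (addEdges G ps) i j ≡ true
addEdges-adj-new (((a , b) , c) ∷ ps) G {i} {j} (_ , here refl , m) =
  addEdges-adj⁺ ps _ (trans (cong (adj G i j ∨_) (sameᵇ⁺ m)) (∨-zeroʳ _))
addEdges-adj-new (_ ∷ ps) G (e , there e∈ , m) = addEdges-adj-new ps _ (e , e∈ , m)

addEdges-adj⁻ : (ps : List (Entry n)) (G : CGraph n) {i j : Fin n} →
  adj (addEdges G ps) i j ≡ true → adj G i j ≡ true ⊎ Covered ps i j
addEdges-adj⁻ [] G eq = inj₁ eq
addEdges-adj⁻ (((a , b) , c) ∷ ps) G {i} {j} eq with addEdges-adj⁻ ps _ eq
... | inj₂ (e , e∈ , m) = inj₂ (e , there e∈ , m)
... | inj₁ eq′ with adj G i j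
...   | true = inj₁ refl
...   | false = inj₂ (_ , here refl , sameᵇ⁻ i j a b eq′)

-- Later entries overwrite earlier ones, so the tail of the list is consulted before its head.
addEdges-col : (ps : List (Entry n)) (G : CGraph n) (i j : Fin n) →
  (∃[ e ] (e ∈ ps × Matches i j e × col (addEdges G ps) i j ≡ proj₂ e))
  ⊎ (Uncovered ps i j × col (addEdges G ps) i j ≡ col G i j)
addEdges-col [] G i j = inj₂ ((λ ()) , refl)
addEdges-col (p@((a , b) , c) ∷ ps) G i j with addEdges-col ps (addEdge G p) i j
... | inj₁ (e , e∈ , m , eq) = inj₁ (e , there e∈ , m , eq)
... | inj₂ (unc , eq) with same? i j a b
...   | yes s = inj₁ (_ , here refl , s ,
          trans eq (cong (if_then c else col G i j) (sameᵇ⁺ s)))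
...   | no ¬s = inj₂ ((λ { (here refl) → ¬s ; (there e∈) → unc e∈ }) ,
          trans eq (cong (if_then c else col G i j) (sameᵇ-false ¬s)))

addEdges-col-sym : (ps : List (Entry n)) (G : CGraph n) → (∀ i j → col G i j ≡ col G j i) →
  ∀ i j → col (addEdges G ps) i j ≡ col (addEdges G ps) j i
addEdges-col-sym [] G sy = sy
addEdges-col-sym (((a , b) , c) ∷ ps) G sy = addEdges-col-sym ps _ λ i j →
  cong₂ (if_then c else_)
    (trans (∨-comm (eqF i a ∧ eqF j b) _)
      (cong₂ _∨_ (∧-comm (eqF i b) _) (∧-comm (eqF i a) _)))
    (sy i j)

-- Lower bound

module _ {H : Adj h} {G : CGraph n} {φ : Fin h → Fin n}
  (Hsym : ∀ i j → H i j ≡ H j i) (Gsym : ∀ i j → col G i j ≡ col G j i)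
  (rainbow : ∀ (x y x′ y′ : Fin h) → H x y ≡ true → H x′ y′ ≡ true → x F.< y → x′ F.< y′
         → (x , y) ≢ (x′ , y′) → col G (φ x) (φ y) ≢ col G (φ x′) (φ y′))
  (Hirr : ∀ i → H i i ≡ false) where

  private
    loop : ∀ {x} → H x x ≢ true
    loop {x} eq = case trans (sym eq) (Hirr x) of λ ()

  -- The rainbow condition only compares edges written with the smaller end first. Symmetry of `H`
  -- and of the colours brings two edges at `x` into this form, whatever the order of `x`, `y` and
  -- `z`.
  rainbow-incident : ∀ {x y z} → H x y ≡ true → H x z ≡ true → y ≢ z →
    col G (φ x) (φ y) ≢ col G (φ x) (φ z)
  rainbow-incident {x} {y} {z} hy hz y≢z eq with <-cmp x y | <-cmp x z
  ... | tri≈ _ refl _ | _ = loop hy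
  ... | _ | tri≈ _ refl _ = loop hz
  ... | tri< x<y _ _ | tri< x<z _ _ = rainbow x y x z hy hz x<y x<z (λ { refl → y≢z refl }) eq
  ... | tri< x<y _ _ | tri> _ _ z<x = rainbow x y z x hy (trans (Hsym z x) hz) x<y z<x
    (λ { refl → loop hy }) (trans eq (Gsym _ _))
  ... | tri> _ _ y<x | tri< x<z _ _ = rainbow y x x z (trans (Hsym y x) hy) hz y<x x<z
    (λ { refl → loop hy }) (trans (Gsym _ _) eq)
  ... | tri> _ _ y<x | tri> _ _ z<x = rainbow y x z x (trans (Hsym y x) hy) (trans (Hsym z x) hz) y<x z<x
    (λ { refl → y≢z refl }) (trans (Gsym _ _) (trans eq (Gsym _ _)))

Touches : Fin n → Fin n × Fin n → Set
Touches v (a , b) = v ≡ a ⊎ v ≡ b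

firstTouching : (v : Fin n) (es : List (Fin n × Fin n)) →
  (∀ {e} → e ∈ es → ¬ Touches v e)
  ⊎ ∃[ xs ] ∃[ e ] ∃[ ys ] (es ≡ xs ++ e ∷ ys × (∀ {e} → e ∈ xs → ¬ Touches v e) × Touches v e)
firstTouching v [] = inj₁ λ ()
firstTouching v ((a , b) ∷ es) with (v ≟F a) ⊎-dec (v ≟F b)
... | yes t = inj₂ ([] , (a , b) , es , refl , (λ ()) , t)
... | no ¬t with firstTouching v es
...   | inj₁ none = inj₁ λ { (here refl) → ¬t ; (there e∈) → none e∈ }
...   | inj₂ (xs , e , ys , refl , none , t) =
        inj₂ ((a , b) ∷ xs , e , ys , refl , (λ { (here refl) → ¬t ; (there e∈) → none e∈ }) , t)

-- An adversarial choice of new colours: `c` at position `p`, and distinct values above `c`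
-- elsewhere.
distinctColours : (c p : ℕ) → ℕ → ℕ
distinctColours c p i with i ℕ.≟ p
... | yes _ = c
... | no _ = suc (c + i)

distinctColours-at : ∀ c p → distinctColours c p p ≡ c
distinctColours-at c p with p ℕ.≟ p
... | yes _ = refl
... | no ¬p = contradiction refl ¬p

distinctColours-injective : ∀ c p {i j} → i < j → distinctColours c p i ≢ distinctColours c p j
distinctColours-injective c p {i} {j} i<j eq with i ℕ.≟ p | j ℕ.≟ p
... | yes refl | yes refl = <-irrefl refl i<j
... | yes _ | no _ = m≢1+m+n c eq
... | no _ | yes _ = m≢1+m+n c (sym eq)
... | no _ | no _ = <-irrefl (+-cancelˡ-≡ c _ _ (suc-injective eq)) i<j

-- Cuts the coloured order at `e` in the form that `WeaklyRainbowSat` asks for.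
zip-split : (xs : List A) (e : A) (ys : List A) (f : ℕ → ℕ) →
  ∃[ pre ] ∃[ post ] (zip (xs ++ e ∷ ys) (applyUpTo f (length (xs ++ e ∷ ys))) ≡ pre ++ (e , f (length xs)) ∷ post
    × (∀ {q} → q ∈ pre → proj₁ q ∈ xs))
zip-split [] e ys f = [] , _ , refl , λ ()
zip-split (x ∷ xs) e ys f with zip-split xs e ys (f ∘ suc)
... | pre , post , eq , sub = (x , f 0) ∷ pre , post , cong ((x , f 0) ∷_) eq ,
  λ { (here refl) → here refl ; (there q∈) → there (sub q∈) }

module MinDegree {H : Adj h} {G : CGraph n} (Hs : IsSimpleAdj H) (Gs : IsSimpleCGraph G)
  (sat : WeaklyRainbowSat H G) (δ : ℕ) (2≤δ : 2 ≤ δ) (δ<n : δ < n)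
  (δ≤ : ∀ x y → H x y ≡ true → δ ≤ deg H x) where

  private
    es = proj₁ sat
    es↭ = proj₁ (proj₂ sat)
    G-sym = proj₁ (proj₁ Gs)

  -- With no non-edge at `v`, all the other `n - 1` vertices are neighbours of `v`, and `δ < n`.
  untouched⇒neighbours : (v : Fin n) → (∀ {e} → e ∈ es → ¬ Touches v e) → δ ≤ deg (adj G) v
  untouched⇒neighbours v none = ≤-pred (≤-trans δ<n
    (subst (_≤ suc (deg (adj G) v)) (length-tabulate {n = n} id) (unique-⊆⇒length≤ (Uniq.allFin⁺ n) sub)))
    where
    adjacent : ∀ j → j ≢ v → adj G v j ≡ true
    adjacent j j≢v with <-cmp v j
    ... | tri≈ _ v≡j _ = contradiction (sym v≡j) j≢v
    ... | tri< v<j _ _ = decidable-stable (_ 𝔹.≟ _) λ ne →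
            none (∈-resp-↭ (↭-sym es↭) (∈-nonEdgeList⁺ (adj G) v<j ne)) (inj₁ refl)
    ... | tri> _ _ j<v = trans (G-sym v j) (decidable-stable (_ 𝔹.≟ _) λ ne →
            none (∈-resp-↭ (↭-sym es↭) (∈-nonEdgeList⁺ (adj G) j<v ne)) (inj₂ refl))
    sub : allFin n ⊆ v ∷ neighbours (adj G) v
    sub {j} _ with j ≟F v
    ... | yes j≡v = here j≡v
    ... | no j≢v = there (∈-neighbours⁺ (adj G) (adjacent j j≢v))

  -- What the copy of H completed by the first new edge v o, of colour c, reveals about G at v.
  CopyNeighbourhood : Fin n → ℕ → Set
  CopyNeighbourhood v c = ∃[ o ] ∃[ ts ] (Unique ts × δ ≤ length ts
    × (∀ t → t ∈ ts → t ≡ o ⊎ (t ∈ neighbours (adj G) v × col G v t ≢ c)))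

  module _ (v : Fin n) (pre : List (Entry n)) (a b : Fin n) (c : ℕ)
    (none : ∀ {q} → q ∈ pre → ¬ Touches v (proj₁ q)) where

    private
      ps = pre ++ [ ((a , b) , c) ]
      G′ = addEdges G ps

      touch : ∀ {i j : Fin n} {q} → Matches i j q → Touches i (proj₁ q)
      touch (inj₁ (p , _)) = inj₁ p
      touch (inj₂ (p , _)) = inj₂ p

      isLast : ∀ {q t} → q ∈ ps → Matches v t q → q ≡ ((a , b) , c)
      isLast {q} q∈ m with ∈-++⁻ pre q∈
      ... | inj₂ (here eq) = eq
      ... | inj₁ q∈pre = contradiction (touch {q = q} m) (none q∈pre)

      col-new : ∀ o → Same v o a b → col G′ v o ≡ c
      col-new o vo with addEdges-col ps G v o
      ... | inj₁ (q , q∈ , m , eq) = trans eq (cong proj₂ (isLast q∈ m))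
      ... | inj₂ (unc , _) = contradiction vo (unc (∈-++⁺ʳ pre (here refl)))

    -- Let `x` be the vertex of `H` placed at `v`; the list `ts` is the image of its neighbours.
    -- Only the last new edge touches `v`, so apart from `o` every image is joined to `v` in `G`.
    -- The joining edge does not have colour `c`, since the new edge `v o` of the same rainbow copy
    -- has it.
    copyNeighbourhood : Touches v (a , b) → RainbowCopyWith H G′ (a , b) → CopyNeighbourhood v c
    copyNeighbourhood touches (φ , φ-inj , φ-edge , φ-rainbow , x₀ , y₀ , hx₀y₀ , px₀ , py₀) = result (ends touches)
      where
      Ends = ∃[ o ] ∃[ x ] ∃[ z ] (H x z ≡ true × φ x ≡ v × φ z ≡ o × Same v o a b)

      ends : Touches v (a , b) → Ends
      ends (inj₁ refl) = b , x₀ , y₀ , hx₀y₀ , px₀ , py₀ , inj₁ (refl , refl)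
      ends (inj₂ refl) = a , y₀ , x₀ , trans (proj₁ Hs y₀ x₀) hx₀y₀ , py₀ , px₀ , inj₂ (refl , refl)

      result : Ends → CopyNeighbourhood v c
      result (o , x , z , hxz , refl , refl , vo) =
        o , map φ (neighbours H x) , Uniq.map⁺ φ-inj (neighbours-unique H x) ,
        subst (δ ≤_) (sym (length-map φ (neighbours H x))) (δ≤ x z hxz) ,
        λ t t∈ → let y , y∈ , eq = ∈-map⁻ φ t∈ in subst Good (sym eq) (good y (∈-neighbours⁻ H y∈))
        where
        Good : Fin n → Set
        Good t = t ≡ o ⊎ (t ∈ neighbours (adj G) v × col G v t ≢ c)
        good : ∀ y → H x y ≡ true → Good (φ y)
        good y hxy with φ y ≟F o
        ... | yes eq = inj₁ eq
        ... | no neq = inj₂ (∈-neighbours⁺ (adj G) adjG , colG)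
          where
          uncov : Uncovered ps v (φ y)
          uncov q∈ m with refl ← isLast q∈ m = neq (same-other m vo)
          adjG : adj G v (φ y) ≡ true
          adjG with addEdges-adj⁻ ps G (φ-edge x y hxy)
          ... | inj₁ eq = eq
          ... | inj₂ (q , q∈ , m) = contradiction m (uncov q∈)
          colG : col G v (φ y) ≢ c
          colG eq with addEdges-col ps G v (φ y)
          ... | inj₁ (q , q∈ , m , _) = uncov q∈ m
          ... | inj₂ (_ , eq′) = rainbow-incident {H = H} {G = G′} (proj₁ Hs) (addEdges-col-sym ps G (proj₂ Gs))
                  φ-rainbow (proj₂ Hs) hxy hxz (neq ∘ cong φ) (trans eq′ (trans eq (sym (col-new o vo))))

  -- Saturation holds for every list of distinct colours, so the first new edge at `v` may be given
  -- any colour `c`.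
  firstCopy : (v : Fin n) → ∀ {xs e ys} → es ≡ xs ++ e ∷ ys → (∀ {e} → e ∈ xs → ¬ Touches v e) → Touches v e →
    (c : ℕ) → CopyNeighbourhood v c
  firstCopy v {xs} {e} {ys} es≡ none t c with zip-split xs e ys (distinctColours c (length xs))
  ... | pre , post , zip≡ , pre⊆ = copyNeighbourhood v pre (proj₁ e) (proj₂ e) c (none ∘ pre⊆) t
    (proj₂ (proj₂ sat) (applyUpTo f (length es))
      (Uniq.applyUpTo⁺₁ f _ (λ i<j _ → distinctColours-injective c (length xs) i<j))
      (length-applyUpTo f (length es)) pre post e c
      (trans (cong (λ l → zip l (applyUpTo f (length l))) es≡)
        (trans zip≡ (cong (λ k → pre ++ (e , k) ∷ post) (distinctColours-at c (length xs))))))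
    where
    f = distinctColours c (length xs)

  δ≤deg : (v : Fin n) → δ ≤ deg (adj G) v
  δ≤deg v with firstTouching v es
  ... | inj₁ none = untouched⇒neighbours v none
  ... | inj₂ (xs , e , ys , es≡ , none , t) = bound (neighbours (adj G) v) refl
    where
    bound : ∀ ws → neighbours (adj G) v ≡ ws → δ ≤ length ws
    -- If `v` had no edge in `G`, then `o` would be its only neighbour in the copy, against `2 ≤ δ`.
    -- The colour 0 is arbitrary.
    bound [] eq with firstCopy v es≡ none t 0
    ... | o , ts , u , le , good = contradiction (≤-trans 2≤δ (≤-trans le
            (unique-⊆⇒length≤ {ys = o ∷ []} u λ t∈ → case good _ t∈ of λ
              { (inj₁ t≡o) → here t≡o
              ; (inj₂ (t∈G , _)) → case subst (_ ∈_) eq t∈G of λ () }))) 1+n≰n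
    -- Repeating the colour of the old edge `v w` excludes `w` from the copy's neighbourhood, unless
    -- `w` is `o`; in the count `o` takes the place of `w`.
    bound (w ∷ ws) eq with firstCopy v es≡ none t (col G v w)
    ... | o , ts , u , le , good = ≤-trans le (unique-⊆⇒length≤ {ys = o ∷ ws} u λ t∈ → case good _ t∈ of λ
              { (inj₁ t≡o) → here t≡o
              ; (inj₂ (t∈G , ne)) → case subst (_ ∈_) eq t∈G of λ
                  { (here refl) → contradiction refl ne
                  ; (there t∈ws) → there t∈ws } })

-- Edge count from minimum degree

module _ (A : Adj n) (Asimple : IsSimpleAdj A) where

  private
    arc? = λ (p : Fin n × Fin n) → T? (A (proj₁ p) (proj₂ p))

    length-filter-map : ∀ x (ys : List (Fin n)) →
      length (filter arc? (map (x ,_) ys)) ≡ length (filter (λ y → T? (A x y)) ys)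
    length-filter-map x [] = refl
    length-filter-map x (y ∷ ys) with A x y
    ... | true = cong suc (length-filter-map x ys)
    ... | false = length-filter-map x ys

    arcs≥ : ∀ d (xs ys : List (Fin n)) → (∀ x → d ≤ length (filter (λ y → T? (A x y)) ys)) →
      length xs * d ≤ length (filter arc? (cartesianProduct xs ys))
    arcs≥ d [] ys _ = z≤n
    arcs≥ d (x ∷ xs) ys b = begin
      d + length xs * d                                    ≤⟨ +-mono-≤ (b x) (arcs≥ d xs ys b) ⟩
      length (filter (λ y → T? (A x y)) ys) + length rest  ≡⟨ cong (_+ length rest) (sym (length-filter-map x ys)) ⟩
      length (filter arc? (map (x ,_) ys)) + length rest   ≡⟨ sym (length-++ (filter arc? (map (x ,_) ys))) ⟩
      length (filter arc? (map (x ,_) ys) ++ rest)         ≡⟨ cong length (sym (filter-++ arc? (map (x ,_) ys) _)) ⟩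
      length (filter arc? (cartesianProduct (x ∷ xs) ys))  ∎
      where
      open ≤-Reasoning
      rest = filter arc? (cartesianProduct xs ys)

  -- Double counting of arcs, the ordered pairs of adjacent vertices: each is an entry of
  -- `edgeList A` or the swap of one.
  minDegree⇒edgeCount : ∀ d → (∀ x → d ≤ deg A x) → n * d ≤ edgeCount A + edgeCount A
  minDegree⇒edgeCount d b = begin
    n * d                                       ≡⟨ cong (_* d) (sym (length-tabulate {n = n} id)) ⟩
    length (allFin n) * d                       ≤⟨ arcs≥ d (allFin n) (allFin n) b ⟩
    length arcs                                 ≤⟨ unique-⊆⇒length≤ arcs-unique sub ⟩
    length (edgeList A ++ map swap (edgeList A)) ≡⟨ length-++ (edgeList A) ⟩
    edgeCount A + length (map swap (edgeList A)) ≡⟨ cong (edgeCount A +_) (length-map swap (edgeList A)) ⟩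
    edgeCount A + edgeCount A ∎
    where
    open ≤-Reasoning
    arcs = filter arc? (cartesianProduct (allFin n) (allFin n))
    arcs-unique : Unique arcs
    arcs-unique = Uniq.filter⁺ arc? (Uniq.cartesianProduct⁺ (Uniq.allFin⁺ n) (Uniq.allFin⁺ n))
    sub : arcs ⊆ edgeList A ++ map swap (edgeList A)
    sub {i , j} p∈ with T⇒true (proj₂ (∈-filter⁻ arc? {xs = cartesianProduct (allFin n) (allFin n)} p∈)) | <-cmp i j
    ... | eq | tri< i<j _ _ = ∈-++⁺ˡ (∈-edgeList⁺ A i<j eq)
    ... | eq | tri≈ _ refl _ = case trans (sym eq) (proj₂ Asimple i) of λ ()
    ... | eq | tri> _ _ j<i = ∈-++⁺ʳ (edgeList A) (∈-map⁺ swap (∈-edgeList⁺ A j<i (trans (proj₁ Asimple j i) eq)))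

-- Upper bound

ordered : Fin n → Fin n → Fin n × Fin n
ordered i j with <-cmp i j
... | tri< _ _ _ = i , j
... | tri≈ _ _ _ = i , j
... | tri> _ _ _ = j , i

ordered-sym : (i j : Fin n) → ordered i j ≡ ordered j i
ordered-sym i j with <-cmp i j | <-cmp j i
... | tri≈ _ refl _ | tri≈ _ _ _ = refl
... | tri≈ _ refl _ | tri< _ _ _ = refl
... | tri≈ _ refl _ | tri> _ _ _ = refl
... | tri< _ _ _ | tri> _ _ _ = refl
... | tri> _ _ _ | tri< _ _ _ = refl
... | tri< i<j _ _ | tri< _ _ i≮j = contradiction i<j i≮j
... | tri< i<j _ _ | tri≈ _ _ i≮j = contradiction i<j i≮j
... | tri> _ _ j<i | tri> j≮i _ _ = contradiction j<i j≮i
... | tri> _ _ j<i | tri≈ j≮i _ _ = contradiction j<i j≮i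

ordered-same : (i j : Fin n) → Same i j (proj₁ (ordered i j)) (proj₂ (ordered i j))
ordered-same i j with <-cmp i j
... | tri< _ _ _ = inj₁ (refl , refl)
... | tri≈ _ _ _ = inj₁ (refl , refl)
... | tri> _ _ _ = inj₂ (refl , refl)

-- The colouring of the starting graph, injective on unordered pairs: `combine` numbers the ordered
-- pairs, and `ordered` picks one of the two orders.
pairColour : Fin n → Fin n → ℕ
pairColour i j = toℕ (uncurry combine (ordered i j))

pairColour-sym : (i j : Fin n) → pairColour i j ≡ pairColour j i
pairColour-sym i j = cong (toℕ ∘ uncurry combine) (ordered-sym i j)

pairColour-injective : (i j i′ j′ : Fin n) → pairColour i j ≡ pairColour i′ j′ → Same i j i′ j′
pairColour-injective i j i′ j′ eq
  with combine-injective (proj₁ (ordered i j)) (proj₂ (ordered i j)) (proj₁ (ordered i′ j′)) (proj₂ (ordered i′ j′))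
         (toℕ-injective eq)
... | p , q = same-trans (ordered-same i j)
  (same-trans (inj₁ (p , q)) (same-sym (ordered-same i′ j′)))

-- At most one pair other than u v has colour c, and some end of it is neither u nor v.
Blocks : ℕ → Fin n → Fin n → List (Fin n) → Set
Blocks c u v Z = length Z ≤ 1 × u ∉ Z × v ∉ Z
  × (∀ i j → i ≢ j → i ∉ Z → j ∉ Z → ¬ Same i j u v → pairColour i j ≢ c)

blocker : (c : ℕ) (u v : Fin n) → ∃[ Z ] Blocks c u v Z
blocker {n} c u v with any? (λ i → any? (λ j →
    ¬? (i ≟F j) ×-dec (¬? (same? i j u v) ×-dec (pairColour i j ℕ.≟ c))))
... | no none = [] , z≤n , (λ ()) , (λ ()) , λ i j i≢j _ _ ¬s eq → none (i , j , i≢j , ¬s , eq)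
... | yes (i , j , i≢j , ¬s , refl) with i ≟F u | i ≟F v
...   | yes refl | _ = [ j ] , s≤s z≤n , (λ { (here refl) → i≢j refl }) , (λ { (here refl) → ¬s (inj₁ (refl , refl)) }) ,
          λ a b _ a∉ b∉ _ eq → case pairColour-injective a b i j eq of λ
            { (inj₁ (_ , refl)) → b∉ (here refl) ; (inj₂ (refl , _)) → a∉ (here refl) }
...   | no _ | yes refl = [ j ] , s≤s z≤n , (λ { (here refl) → ¬s (inj₂ (refl , refl)) }) , (λ { (here refl) → i≢j refl }) ,
          λ a b _ a∉ b∉ _ eq → case pairColour-injective a b i j eq of λ
            { (inj₁ (_ , refl)) → b∉ (here refl) ; (inj₂ (refl , _)) → a∉ (here refl) }
...   | no i≢u | no i≢v = [ i ] , s≤s z≤n , (λ { (here refl) → i≢u refl }) , (λ { (here refl) → i≢v refl }) ,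
          λ a b _ a∉ b∉ _ eq → case pairColour-injective a b i j eq of λ
            { (inj₁ (refl , _)) → a∉ (here refl) ; (inj₂ (_ , refl)) → b∉ (here refl) }

map-proj₁-zip : (xs : List A) (ys : List B) → length ys ≡ length xs → map proj₁ (zip xs ys) ≡ xs
map-proj₁-zip [] _ _ = refl
map-proj₁-zip (x ∷ xs) (y ∷ ys) eq = cong (x ∷_) (map-proj₁-zip xs ys (suc-injective eq))

∈-zip⇒∈₂ : (xs : List A) (ys : List B) {q : A × B} → q ∈ zip xs ys → proj₂ q ∈ ys
∈-zip⇒∈₂ (x ∷ xs) (y ∷ ys) (here refl) = here refl
∈-zip⇒∈₂ (x ∷ xs) (y ∷ ys) (there q∈) = there (∈-zip⇒∈₂ xs ys q∈)

-- Among the new edges a colour determines its edge, because it occurs only once in the colour list.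
zip-functional : (xs : List A) {ys : List B} → Unique ys → {q q′ : A × B} →
  q ∈ zip xs ys → q′ ∈ zip xs ys → proj₂ q ≡ proj₂ q′ → proj₁ q ≡ proj₁ q′
zip-functional (x ∷ xs) (y∉ ∷ u) (here refl) (here refl) eq = refl
zip-functional (x ∷ xs) (y∉ ∷ u) (here refl) (there q′∈) eq = contradiction eq (All.lookup y∉ (∈-zip⇒∈₂ xs _ q′∈))
zip-functional (x ∷ xs) (y∉ ∷ u) (there q∈) (here refl) eq = contradiction (sym eq) (All.lookup y∉ (∈-zip⇒∈₂ xs _ q∈))
zip-functional (x ∷ xs) (_ ∷ u) (there q∈) (there q′∈) eq = zip-functional xs u q∈ q′∈ eq

-- Applied with `xs` the first phase of the order: when an edge `e` outside that phase is added, the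
-- whole phase has been added before it.
++-prefix : (xs : List A) {ys ps qs : List A} {e : A} →
  xs ++ ys ≡ ps ++ e ∷ qs → e ∉ xs → xs ⊆ ps
++-prefix [] _ _ ()
++-prefix (x ∷ xs) {ps = []} refl e∉ _ = contradiction (here refl) e∉
++-prefix (x ∷ xs) {ps = p ∷ ps} eq e∉ x∈ with ∷-injective eq | x∈
... | refl , eq′ | here refl = here refl
... | refl , eq′ | there x∈xs = there (++-prefix xs eq′ (e∉ ∘ there) x∈xs)

does-true⇒ : {P : Set} (P? : Dec P) → does P? ≡ true → P
does-true⇒ (yes p) _ = p

length-cartesianProduct : (xs : List A) (ys : List B) →
  length (cartesianProduct xs ys) ≡ length xs * length ys
length-cartesianProduct [] ys = refl
length-cartesianProduct (x ∷ xs) ys = trans (length-++ (map (x ,_) ys))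
  (cong₂ _+_ (length-map (x ,_) ys) (length-cartesianProduct xs ys))

-- The starting graph

module Construction (s K : ℕ) (M≤n : s + K ≤ n) where

  M = s + K

  -- The vertices below `s` are universal, those below `M` form the clique, and the others are the
  -- outside vertices.
  Joined : Fin n → Fin n → Set
  Joined i j = i ≢ j × ((toℕ i < s ⊎ toℕ j < s) ⊎ (toℕ i < M × toℕ j < M))

  joined? : ∀ i j → Dec (Joined i j)
  joined? i j = ¬? (i ≟F j) ×-dec
    (((toℕ i ℕ.<? s) ⊎-dec (toℕ j ℕ.<? s)) ⊎-dec ((toℕ i ℕ.<? M) ×-dec (toℕ j ℕ.<? M)))

  joined-sym : ∀ {i j} → Joined i j → Joined j i
  joined-sym (i≢j , inj₁ (inj₁ p)) = i≢j ∘ sym , inj₁ (inj₂ p)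
  joined-sym (i≢j , inj₁ (inj₂ p)) = i≢j ∘ sym , inj₁ (inj₁ p)
  joined-sym (i≢j , inj₂ (p , q)) = i≢j ∘ sym , inj₂ (q , p)

  G : CGraph n
  G = cgraph (λ i j → does (joined? i j)) pairColour

  G-simple : IsSimpleCGraph G
  G-simple = ((λ i j → does-⇔ (mk⇔ joined-sym joined-sym) (joined? i j) (joined? j i)) ,
              (λ i → dec-false (joined? i i) (λ (i≢i , _) → i≢i refl))) ,
             pairColour-sym

  s≤n : s ≤ n
  s≤n = ≤-trans (m≤m+n s K) M≤n

  -- A crude count: edges at universal vertices lie in a product of size `s * n`, all others in one
  -- of size `M * M`, which is constant in `n`.
  edgeCount≤ : edgeCount (adj G) ≤ s * n + M * M
  edgeCount≤ = begin
    edgeCount (adj G)                ≤⟨ unique-⊆⇒length≤ (Uniq.filter⁺ _ (upperPairs-unique n)) sub ⟩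
    length (stars ++ clique)         ≡⟨ length-++ stars ⟩
    length stars + length clique     ≡⟨ cong₂ _+_ (length-cartesianProduct (block 0 s s≤n) (allFin n))
                                                  (length-cartesianProduct (block 0 M M≤n) (block 0 M M≤n)) ⟩
    length (block 0 s s≤n) * length (allFin n) + length (block 0 M M≤n) * length (block 0 M M≤n)
      ≡⟨ cong₂ _+_ (cong₂ _*_ (length-block 0 s s≤n) (length-tabulate {n = n} id))
                   (cong₂ _*_ (length-block 0 M M≤n) (length-block 0 M M≤n)) ⟩
    s * n + M * M ∎
    where
    open ≤-Reasoning
    stars = cartesianProduct (block 0 s s≤n) (allFin n)
    clique = cartesianProduct (block 0 M M≤n) (block 0 M M≤n)
    star∈ : ∀ i j → toℕ i < s → (i , j) ∈ stars ++ clique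
    star∈ i j i<s = ∈-++⁺ˡ (∈-cartesianProduct⁺ (∈-block⁺ 0 s s≤n z≤n i<s) (∈-allFin j))
    sub : edgeList (adj G) ⊆ stars ++ clique
    sub {i , j} p∈ with ∈-filter⁻ _ {xs = upperPairs n} p∈
    ... | p∈u , t with does-true⇒ (joined? i j) (T⇒true t)
    ...   | _ , inj₁ (inj₁ i<s) = star∈ i j i<s
    -- Edges are listed with the smaller end first, so `i` is universal too.
    ...   | _ , inj₁ (inj₂ j<s) = star∈ i j (<-trans (∈-upperPairs⁻ p∈u) j<s)
    ...   | _ , inj₂ (i<M , j<M) = ∈-++⁺ʳ stars
              (∈-cartesianProduct⁺ (∈-block⁺ 0 M M≤n z≤n i<M) (∈-block⁺ 0 M M≤n z≤n j<M))

  -- Rainbow copies after adding an initial part of the new edges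

  module Step {H : Adj h} (Hs : IsSimpleAdj H) (ps : List (Entry n))
    (functional : ∀ {q q′} → q ∈ ps → q′ ∈ ps → proj₂ q ≡ proj₂ q′ → proj₁ q ≡ proj₁ q′)
    (nonEdges : ∀ {q} → q ∈ ps → ¬ Joined (proj₁ (proj₁ q)) (proj₂ (proj₁ q))) where

    G′ = addEdges G ps

    H-loop : ∀ {x} → H x x ≢ true
    H-loop {x} eq = case trans (sym eq) (proj₂ Hs x) of λ ()

    edge-≢ : {φ : Fin h → Fin n} → Injective _≡_ _≡_ φ → ∀ {a b} → H a b ≡ true → φ a ≢ φ b
    edge-≢ φ-inj {a} {b} hab eq with refl ← φ-inj {a} {b} eq = H-loop hab

    G′-sym : ∀ i j → col G′ i j ≡ col G′ j i
    G′-sym = addEdges-col-sym ps G pairColour-sym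

    G′-same : ∀ {i j a b} → Same i j a b → col G′ i j ≡ col G′ a b
    G′-same (inj₁ (refl , refl)) = refl
    G′-same (inj₂ (refl , refl)) = G′-sym _ _

    covered⇒¬joined : ∀ {i j} → Covered ps i j → ¬ Joined i j
    covered⇒¬joined (q , q∈ , inj₁ (refl , refl)) jn = nonEdges q∈ jn
    covered⇒¬joined (q , q∈ , inj₂ (refl , refl)) jn = nonEdges q∈ (joined-sym jn)

    covered-resp : ∀ {i j a b} → Same i j a b → Covered ps a b → Covered ps i j
    covered-resp s (q , q∈ , m) = q , q∈ , same-trans s m

    -- New colours are distinct and so are the old ones: only an old and a new edge can clash.
    rainbowCopy : (φ : Fin h → Fin n) → Injective _≡_ _≡_ φ →
      (∀ x y → H x y ≡ true → Joined (φ x) (φ y) ⊎ Covered ps (φ x) (φ y)) →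
      (∀ x y x′ y′ → H x y ≡ true → H x′ y′ ≡ true → Covered ps (φ x) (φ y) → Uncovered ps (φ x′) (φ y′) →
         col G′ (φ x) (φ y) ≢ pairColour (φ x′) (φ y′)) →
      ∀ x y → H x y ≡ true → RainbowCopyWith H G′ (φ x , φ y)
    rainbowCopy φ φ-inj edges clash x₀ y₀ h₀ =
      φ , φ-inj , (λ x y hxy → case edges x y hxy of λ
          { (inj₁ jn) → addEdges-adj⁺ ps G (dec-true (joined? _ _) jn)
          ; (inj₂ cv) → addEdges-adj-new ps G cv }) ,
      rainbow , x₀ , y₀ , h₀ , refl , refl
      where
      distinct : ∀ {x y x′ y′ : Fin h} → x F.< y → x′ F.< y′ → (x , y) ≢ (x′ , y′) →
        ¬ Same (φ x) (φ y) (φ x′) (φ y′)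
      distinct x<y x′<y′ ne (inj₁ (p , q)) = ne (cong₂ _,_ (φ-inj p) (φ-inj q))
      distinct x<y x′<y′ ne (inj₂ (p , q)) with refl ← φ-inj p | refl ← φ-inj q = <-asym x<y x′<y′
      rainbow : ∀ (x y x′ y′ : Fin h) → H x y ≡ true → H x′ y′ ≡ true → x F.< y → x′ F.< y′
         → (x , y) ≢ (x′ , y′) → col G′ (φ x) (φ y) ≢ col G′ (φ x′) (φ y′)
      rainbow x y x′ y′ hxy hxy′ x<y x′<y′ ne eq
        with addEdges-col ps G (φ x) (φ y) | addEdges-col ps G (φ x′) (φ y′)
      ... | inj₂ (_ , e) | inj₂ (_ , e′) = distinct x<y x′<y′ ne
              (pairColour-injective _ _ _ _ (trans (sym e) (trans eq e′)))
      ... | inj₁ (q , q∈ , m , e) | inj₂ (unc , e′) =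
              clash x y x′ y′ hxy hxy′ (q , q∈ , m) unc (trans eq e′)
      ... | inj₂ (unc , e) | inj₁ (q , q∈ , m , e′) =
              clash x′ y′ x y hxy′ hxy (q , q∈ , m) unc (trans (sym eq) e)
      ... | inj₁ (((a , b) , _) , q∈ , m , e) | inj₁ (((a′ , b′) , _) , q′∈ , m′ , e′)
        with functional q∈ q′∈ (trans (sym e) (trans eq e′))
      ...   | refl = distinct x<y x′<y′ ne (same-trans m (same-sym m′))

    -- An edge from a clique vertex to an outside vertex v, which plays a vertex p of degree d + 1:
    -- deleting a vertex of the clique kills the only edge whose colour may clash.
    cliqueStep : ∀ {d p x} → H p x ≡ true → deg H p ≡ suc d → d ≤ s ∸ 1 → h + 2 ≤ K →
      ∀ u v → s ≤ toℕ u → toℕ u < M → M ≤ toℕ v → Covered ps u v → RainbowCopyWith H G′ (u , v)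
    cliqueStep {d} {p} {x} hpx degp d≤ K≥ u v s≤u u<M M≤v cov with blocker (col G′ u v) u v
    ... | Z , Z≤1 , u∉Z , v∉Z , avoid
      with truncate (neighbours H p ∖ [ x ]) (block 0 s s≤n ∖ Z) few (∖-unique Z (block-unique 0 s s≤n))
         | truncate (allFin h ∖ (p ∷ neighbours H p)) (block s K M≤n ∖ (u ∷ Z)) few′ (∖-unique (u ∷ Z) (block-unique s K M≤n))
      where
      open ≤-Reasoning
      -- The `d` neighbours of `p` other than `x` go to universal vertices, the neighbours of `v` in
      -- the starting graph. One of these may be lost to `Z`, whence `s ∸ 1`; truncated subtraction
      -- also covers `d = 0` with `s = 0`.
      few : length (neighbours H p ∖ [ x ]) ≤ length (block 0 s s≤n ∖ Z)
      few = begin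
        length (neighbours H p ∖ [ x ]) ≤⟨ ≤-pred (≤-trans
          (unique-⊆⇒length≤ {ys = neighbours H p}
            (All.tabulate (λ y∈ x≡y → proj₂ (∈-∖⁻ (neighbours H p) [ x ] y∈) (here (sym x≡y)))
              ∷ ∖-unique [ x ] (neighbours-unique H p))
            (λ { (here refl) → ∈-neighbours⁺ H hpx ; (there y∈) → proj₁ (∈-∖⁻ (neighbours H p) [ x ] y∈) }))
          (≤-reflexive degp)) ⟩
        d                                            ≤⟨ d≤ ⟩
        s ∸ 1                                        ≤⟨ ∸-monoˡ-≤ 1 (≤-trans (≤-reflexive (sym (length-block 0 s s≤n)))
                                                         (length-∖ Z (block-unique 0 s s≤n))) ⟩
        (length (block 0 s s≤n ∖ Z) + length Z) ∸ 1  ≤⟨ ∸-monoˡ-≤ 1 (+-monoʳ-≤ (length (block 0 s s≤n ∖ Z)) Z≤1) ⟩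
        (length (block 0 s s≤n ∖ Z) + 1) ∸ 1         ≡⟨ m+n∸n≡m (length (block 0 s s≤n ∖ Z)) 1 ⟩
        length (block 0 s s≤n ∖ Z) ∎
      -- The summand 2 in `h + 2` pays for `u` and for `Z`.
      few′ : length (allFin h ∖ (p ∷ neighbours H p)) ≤ length (block s K M≤n ∖ (u ∷ Z))
      few′ = ≤-trans (length-filter _ (allFin h)) (subst (_≤ length (block s K M≤n ∖ (u ∷ Z))) (sym (length-tabulate {n = h} id))
        (+-cancelʳ-≤ 2 _ _ (begin
          h + 2 ≤⟨ K≥ ⟩
          K ≡⟨ sym (length-block s K M≤n) ⟩
          length (block s K M≤n) ≤⟨ length-∖ (u ∷ Z) (block-unique s K M≤n) ⟩
          length (block s K M≤n ∖ (u ∷ Z)) + suc (length Z) ≤⟨ +-monoʳ-≤ _ (s≤s Z≤1) ⟩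
          length (block s K M≤n ∖ (u ∷ Z)) + 2 ∎)))
    ... | T₁ , pw₁ , u₁ , sub₁ | T₂ , pw₂ , u₂ , sub₂ =
      conclude (pointwise⇒injection placement targets-unique cover)
      where
      -- The vertex `p` goes to `v` and `x` to `u`, the other neighbours of `p` to universal
      -- vertices, and the remaining vertices of `H` elsewhere in the clique.
      record Placed (y : Fin h) (t : Fin n) : Set where
        field
          at-p : y ≡ p → t ≡ v
          inside : y ≢ p → toℕ t < M
          near : H p y ≡ true → t ≡ u ⊎ toℕ t < s
          at-x : y ≡ x → t ≡ u
          free : t ∉ Z

      inT₁ : ∀ {t} → t ∈ block 0 s s≤n ∖ Z → toℕ t < s × t ∉ Z
      inT₁ t∈ = let t∈b , t∉Z = ∈-∖⁻ (block 0 s s≤n) Z t∈ in proj₂ (∈-block 0 s s≤n t∈b) , t∉Z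
      inT₂ : ∀ {t} → t ∈ block s K M≤n ∖ (u ∷ Z) → (s ≤ toℕ t × toℕ t < M) × t ∉ u ∷ Z
      inT₂ t∈ = let t∈b , t∉Z = ∈-∖⁻ (block s K M≤n) (u ∷ Z) t∈ in ∈-block s K M≤n t∈b , t∉Z

      placed₁ : ∀ {y t} → y ∈ neighbours H p ∖ [ x ] × t ∈ block 0 s s≤n ∖ Z → Placed y t
      placed₁ (y∈ , t∈) with ∈-∖⁻ (neighbours H p) [ x ] y∈ | inT₁ t∈
      ... | y∈N , y≢x | t<s , t∉Z = record
        { at-p = λ { refl → contradiction (∈-neighbours⁻ H y∈N) H-loop }
        ; inside = λ _ → <-≤-trans t<s (m≤m+n s K)
        ; near = λ _ → inj₂ t<s
        ; at-x = λ y≡x → contradiction (here y≡x) y≢x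
        ; free = t∉Z }

      placed₂ : ∀ {y t} → y ∈ allFin h ∖ (p ∷ neighbours H p) × t ∈ block s K M≤n ∖ (u ∷ Z) → Placed y t
      placed₂ (y∈ , t∈) with ∈-∖⁻ (allFin h) (p ∷ neighbours H p) y∈ | inT₂ t∈
      ... | _ , y∉ | (_ , t<M) , t∉ = record
        { at-p = λ y≡p → contradiction (here y≡p) y∉
        ; inside = λ _ → t<M
        ; near = λ hpy → contradiction (there (∈-neighbours⁺ H hpy)) y∉
        ; at-x = λ { refl → contradiction (there (∈-neighbours⁺ H hpx)) y∉ }
        ; free = t∉ ∘ there }

      placement : Pointwise Placed (p ∷ x ∷ (neighbours H p ∖ [ x ]) ++ (allFin h ∖ (p ∷ neighbours H p))) (v ∷ u ∷ T₁ ++ T₂)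
      placement =
        record { at-p = λ _ → refl ; inside = λ ne → contradiction refl ne ; near = λ hpp → contradiction hpp H-loop
               ; at-x = λ { refl → contradiction hpx H-loop } ; free = v∉Z } ∷
        record { at-p = λ { refl → contradiction hpx H-loop } ; inside = λ _ → u<M ; near = λ _ → inj₁ refl
               ; at-x = λ _ → refl ; free = u∉Z } ∷
        PW.++⁺ (PW.map placed₁ pw₁) (PW.map placed₂ pw₂)

      targets-unique : Unique (v ∷ u ∷ T₁ ++ T₂)
      targets-unique = All.tabulate v-fresh ∷ All.tabulate u-fresh ∷
        Uniq.++⁺ u₁ u₂ (λ (t∈₁ , t∈₂) → <⇒≱ (proj₁ (inT₁ (sub₁ t∈₁))) (proj₁ (proj₁ (inT₂ (sub₂ t∈₂)))))
        where
        u-fresh : ∀ {t} → t ∈ T₁ ++ T₂ → u ≢ t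
        u-fresh t∈ refl with ∈-++⁻ T₁ t∈
        ... | inj₁ t∈₁ = <⇒≱ (proj₁ (inT₁ (sub₁ t∈₁))) s≤u
        ... | inj₂ t∈₂ = proj₂ (inT₂ (sub₂ t∈₂)) (here refl)
        v-fresh : ∀ {t} → t ∈ u ∷ T₁ ++ T₂ → v ≢ t
        v-fresh (here refl) refl = <⇒≱ u<M M≤v
        v-fresh (there t∈) refl with ∈-++⁻ T₁ t∈
        ... | inj₁ t∈₁ = <⇒≱ (<-≤-trans (proj₁ (inT₁ (sub₁ t∈₁))) (m≤m+n s K)) M≤v
        ... | inj₂ t∈₂ = <⇒≱ (proj₂ (proj₁ (inT₂ (sub₂ t∈₂)))) M≤v

      cover : ∀ y → y ∈ p ∷ x ∷ (neighbours H p ∖ [ x ]) ++ (allFin h ∖ (p ∷ neighbours H p))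
      cover y with y ≟F p | y ≟F x | DecMem._∈?_ _≟F_ y (neighbours H p)
      ... | yes eq | _ | _ = here eq
      ... | no _ | yes eq | _ = there (here eq)
      ... | no _ | no ne | yes y∈ = there (there (∈-++⁺ˡ (∈-∖⁺ y∈ λ { (here eq) → ne eq })))
      ... | no y≢p | no _ | no y∉ = there (there (∈-++⁺ʳ (neighbours H p ∖ [ x ])
              (∈-∖⁺ (∈-allFin y) λ { (here eq) → y≢p eq ; (there y∈) → y∉ y∈ })))

      conclude : ∃[ φ ] (Injective _≡_ _≡_ φ × (∀ y → Placed y (φ y))) → RainbowCopyWith H G′ (u , v)
      conclude (φ , φ-inj , φ-placed) =
        subst (RainbowCopyWith H G′) (cong₂ _,_ (φ-x x refl) (φ-p p refl))
          (rainbowCopy φ φ-inj edges clash x p (trans (proj₁ Hs x p) hpx))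
        where
          φ-p = λ y → Placed.at-p (φ-placed y)
          φ-x = λ y → Placed.at-x (φ-placed y)

          φ-≢ : ∀ {a b} → H a b ≡ true → φ a ≢ φ b
          φ-≢ = edge-≢ φ-inj

          from-p : ∀ b → H p b ≡ true → Joined (φ p) (φ b) ⊎ Same (φ p) (φ b) u v
          from-p b hpb with Placed.near (φ-placed b) hpb
          ... | inj₁ eq = inj₂ (inj₂ (φ-p p refl , eq))
          ... | inj₂ lt = inj₁ (φ-≢ hpb , inj₁ (inj₂ lt))

          -- Apart from `u v` the copy uses only edges of the starting graph, so only the colour of
          -- `u v` can clash.
          old-or-uv : ∀ a b → H a b ≡ true → Joined (φ a) (φ b) ⊎ Same (φ a) (φ b) u v
          old-or-uv a b hab with a ≟F p | b ≟F p
          ... | yes refl | _ = from-p b hab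
          ... | no _ | yes refl = case from-p a (trans (proj₁ Hs p a) hab) of λ
                  { (inj₁ jn) → inj₁ (joined-sym jn) ; (inj₂ sm) → inj₂ (same-swap sm) }
          ... | no a≢p | no b≢p = inj₁ (φ-≢ hab , inj₂ (Placed.inside (φ-placed a) a≢p , Placed.inside (φ-placed b) b≢p))

          edges : ∀ a b → H a b ≡ true → Joined (φ a) (φ b) ⊎ Covered ps (φ a) (φ b)
          edges a b hab with old-or-uv a b hab
          ... | inj₁ jn = inj₁ jn
          ... | inj₂ sm = inj₂ (covered-resp sm cov)

          clash : ∀ a b a′ b′ → H a b ≡ true → H a′ b′ ≡ true → Covered ps (φ a) (φ b) → Uncovered ps (φ a′) (φ b′) →
             col G′ (φ a) (φ b) ≢ pairColour (φ a′) (φ b′)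
          clash a b a′ b′ hab hab′ cv unc eq with old-or-uv a b hab
          ... | inj₁ jn = covered⇒¬joined cv jn
          ... | inj₂ sm = avoid (φ a′) (φ b′) (φ-≢ hab′) (Placed.free (φ-placed a′)) (Placed.free (φ-placed b′))
                  (λ sm′ → let q , q∈ , m = covered-resp sm′ cov in unc q∈ m)
                  (trans (sym eq) (G′-same sm))

    -- An edge between outside vertices, both already joined to all of the clique: the other vertices of H
    -- go to a set of clique vertices w such that neither w v nor w v′ shares its colour with a pair in the set.
    outerStep : ∀ {x₀ y₀} → H x₀ y₀ ≡ true → indepBound 2 h + 1 ≤ K →
      ∀ v v′ → v ≢ v′ → M ≤ toℕ v → M ≤ toℕ v′ → Covered ps v v′ →
      (∀ w → s ≤ toℕ w → toℕ w < M → Covered ps w v × Covered ps w v′) →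
      RainbowCopyWith H G′ (v , v′)
    outerStep {x₀} {y₀} h₀ K≥ v v′ v≢v′ M≤v M≤v′ cov covW with blocker (col G′ v v′) v v′
    ... | Z , Z≤1 , v∉Z , v′∉Z , avoid
      with independentSet out 2 out≤2 h {block s K M≤n ∖ Z} (∖-unique Z (block-unique s K M≤n)) enough
      where
      open ≤-Reasoning
      -- The conflict digraph: one blocker for `w v` and one for `w v′`, each of at most one vertex,
      -- give the out-degree 2 in `indepBound 2 h`. The further 1 in the bound on `K` pays for `Z`,
      -- which handles the colour of `v v′`.
      out : Fin n → List (Fin n)
      out w = proj₁ (blocker (col G′ w v) w v) ++ proj₁ (blocker (col G′ w v′) w v′)
      out≤2 : ∀ w → length (out w) ≤ 2
      out≤2 w = subst (_≤ 2) (sym (length-++ (proj₁ (blocker (col G′ w v) w v))))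
        (+-mono-≤ (proj₁ (proj₂ (blocker (col G′ w v) w v))) (proj₁ (proj₂ (blocker (col G′ w v′) w v′))))
      enough : indepBound 2 h ≤ length (block s K M≤n ∖ Z)
      enough = +-cancelʳ-≤ 1 _ _ (begin
        indepBound 2 h + 1 ≤⟨ K≥ ⟩
        K ≡⟨ sym (length-block s K M≤n) ⟩
        length (block s K M≤n) ≤⟨ length-∖ Z (block-unique s K M≤n) ⟩
        length (block s K M≤n ∖ Z) + length Z ≤⟨ +-monoʳ-≤ _ Z≤1 ⟩
        length (block s K M≤n ∖ Z) + 1 ∎)
    ... | S , lenS , uS , S⊆ , indep
      with truncate (allFin h ∖ (x₀ ∷ y₀ ∷ [])) S
             (≤-trans (length-filter _ (allFin h)) (≤-reflexive (trans (length-tabulate {n = h} id) (sym lenS)))) uS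
    ... | T₁ , pw , uT , T⊆ = conclude (pointwise⇒injection placement targets-unique cover)
      where
      inS : ∀ {t} → t ∈ S → (s ≤ toℕ t × toℕ t < M) × t ∉ Z
      inS t∈ = let t∈b , t∉Z = ∈-∖⁻ (block s K M≤n) Z (S⊆ t∈) in ∈-block s K M≤n t∈b , t∉Z

      outside : ∀ {t z} → t ∈ S → M ≤ toℕ z → t ≢ z
      outside t∈ M≤z refl = <⇒≱ (proj₂ (proj₁ (inS t∈))) M≤z

      Placed : Fin h → Fin n → Set
      Placed y t = (y ≡ x₀ × t ≡ v) ⊎ (y ≡ y₀ × t ≡ v′) ⊎ (y ∉ x₀ ∷ y₀ ∷ [] × t ∈ S)

      placement : Pointwise Placed (x₀ ∷ y₀ ∷ allFin h ∖ (x₀ ∷ y₀ ∷ [])) (v ∷ v′ ∷ T₁)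
      placement = inj₁ (refl , refl) ∷ inj₂ (inj₁ (refl , refl)) ∷
        PW.map (λ (y∈ , t∈) → inj₂ (inj₂ (proj₂ (∈-∖⁻ (allFin h) (x₀ ∷ y₀ ∷ []) y∈) , t∈))) pw

      targets-unique : Unique (v ∷ v′ ∷ T₁)
      targets-unique =
        (v≢v′ ∷ All.tabulate (λ t∈ → outside (T⊆ t∈) M≤v ∘ sym)) ∷
        All.tabulate (λ t∈ → outside (T⊆ t∈) M≤v′ ∘ sym) ∷ uT

      cover : ∀ y → y ∈ x₀ ∷ y₀ ∷ allFin h ∖ (x₀ ∷ y₀ ∷ [])
      cover y with DecMem._∈?_ _≟F_ y (x₀ ∷ y₀ ∷ [])
      ... | yes (here eq) = here eq
      ... | yes (there (here eq)) = there (here eq)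
      ... | no y∉ = there (there (∈-∖⁺ (∈-allFin y) y∉))

      conclude : ∃[ φ ] (Injective _≡_ _≡_ φ × (∀ y → Placed y (φ y))) → RainbowCopyWith H G′ (v , v′)
      conclude (φ , φ-inj , φ-placed) =
        subst (RainbowCopyWith H G′) (cong₂ _,_ (at-x₀ refl) (at-y₀ refl))
          (rainbowCopy φ φ-inj edges clash x₀ y₀ h₀)
        where

          φ-≢ : ∀ {a b} → H a b ≡ true → φ a ≢ φ b
          φ-≢ = edge-≢ φ-inj

          at-x₀ : ∀ {y} → y ≡ x₀ → φ y ≡ v
          at-x₀ {y} y≡ with φ-placed y
          ... | inj₁ (_ , eq) = eq
          ... | inj₂ (inj₁ (y≡y₀ , _)) with refl ← trans (sym y≡) y≡y₀ = contradiction h₀ H-loop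
          ... | inj₂ (inj₂ (y∉ , _)) = contradiction (here y≡) y∉

          at-y₀ : ∀ {y} → y ≡ y₀ → φ y ≡ v′
          at-y₀ {y} y≡ with φ-placed y
          ... | inj₁ (y≡x₀ , _) with refl ← trans (sym y≡) y≡x₀ = contradiction h₀ H-loop
          ... | inj₂ (inj₁ (_ , eq)) = eq
          ... | inj₂ (inj₂ (y∉ , _)) = contradiction (there (here y≡)) y∉

          -- Vertices of `S` are not universal, so all spokes are new edges, and only edges inside
          -- `S` keep a colour of the starting graph.
          data Kind (i j : Fin n) : Set where
            new : Same i j v v′ → Kind i j
            spoke : ∀ {w} → w ∈ S → Same i j w v → Kind i j
            spoke′ : ∀ {w} → w ∈ S → Same i j w v′ → Kind i j
            old : i ∈ S → j ∈ S → Kind i j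

          kind : ∀ a b → H a b ≡ true → Kind (φ a) (φ b)
          kind a b hab with φ-placed a | φ-placed b
          ... | inj₁ (_ , p) | inj₁ (_ , q) = contradiction (trans p (sym q)) (φ-≢ hab)
          ... | inj₁ (_ , p) | inj₂ (inj₁ (_ , q)) = new (inj₁ (p , q))
          ... | inj₁ (_ , p) | inj₂ (inj₂ (_ , q)) = spoke q (inj₂ (p , refl))
          ... | inj₂ (inj₁ (_ , p)) | inj₁ (_ , q) = new (inj₂ (p , q))
          ... | inj₂ (inj₁ (_ , p)) | inj₂ (inj₁ (_ , q)) = contradiction (trans p (sym q)) (φ-≢ hab)
          ... | inj₂ (inj₁ (_ , p)) | inj₂ (inj₂ (_ , q)) = spoke′ q (inj₂ (p , refl))
          ... | inj₂ (inj₂ (_ , p)) | inj₁ (_ , q) = spoke p (inj₁ (refl , q))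
          ... | inj₂ (inj₂ (_ , p)) | inj₂ (inj₁ (_ , q)) = spoke′ p (inj₁ (refl , q))
          ... | inj₂ (inj₂ (_ , p)) | inj₂ (inj₂ (_ , q)) = old p q

          covered : ∀ {w} → w ∈ S → Covered ps w v × Covered ps w v′
          covered w∈ = let (s≤w , w<M) , _ = inS w∈ in covW _ s≤w w<M

          old-joined : ∀ {i j} → i ≢ j → i ∈ S → j ∈ S → Joined i j
          old-joined i≢j i∈ j∈ = i≢j , inj₂ (proj₂ (proj₁ (inS i∈)) , proj₂ (proj₁ (inS j∈)))

          kind-covered : ∀ {i j} → i ≢ j → Kind i j → Joined i j ⊎ Covered ps i j
          kind-covered _ (new sm) = inj₂ (covered-resp sm cov)
          kind-covered _ (spoke w∈ sm) = inj₂ (covered-resp sm (proj₁ (covered w∈)))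
          kind-covered _ (spoke′ w∈ sm) = inj₂ (covered-resp sm (proj₂ (covered w∈)))
          kind-covered i≢j (old i∈ j∈) = inj₁ (old-joined i≢j i∈ j∈)

          edges : ∀ a b → H a b ≡ true → Joined (φ a) (φ b) ⊎ Covered ps (φ a) (φ b)
          edges a b hab = kind-covered (φ-≢ hab) (kind a b hab)

          uncovered⇒∈S : ∀ {i j} → Kind i j → Uncovered ps i j → i ∈ S × j ∈ S
          uncovered⇒∈S (old i∈ j∈) _ = i∈ , j∈
          uncovered⇒∈S (new sm) unc = let q , q∈ , m = covered-resp sm cov in ⊥-elim (unc q∈ m)
          uncovered⇒∈S (spoke w∈ sm) unc = let q , q∈ , m = covered-resp sm (proj₁ (covered w∈)) in ⊥-elim (unc q∈ m)
          uncovered⇒∈S (spoke′ w∈ sm) unc = let q , q∈ , m = covered-resp sm (proj₂ (covered w∈)) in ⊥-elim (unc q∈ m)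

          not-outside : ∀ {i j w z} → i ∈ S → j ∈ S → M ≤ toℕ z → ¬ Same i j w z
          not-outside i∈ j∈ M≤z (inj₁ (_ , eq)) = outside j∈ M≤z eq
          not-outside i∈ j∈ M≤z (inj₂ (eq , _)) = outside i∈ M≤z eq

          -- A blocker of `w v` avoids `w` itself; any other vertex of `S` avoids it by
          -- independence.
          free : ∀ {i w} → i ∈ S → w ∈ S → i ∉ proj₁ (blocker (col G′ w v) w v)
          free {i} {w} i∈ w∈ i∈Z with w ≟F i
          ... | yes refl = proj₁ (proj₂ (proj₂ (blocker (col G′ w v) w v))) i∈Z
          ... | no w≢i = indep w∈ i∈ w≢i (∈-++⁺ˡ i∈Z)

          free′ : ∀ {i w} → i ∈ S → w ∈ S → i ∉ proj₁ (blocker (col G′ w v′) w v′)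
          free′ {i} {w} i∈ w∈ i∈Z with w ≟F i
          ... | yes refl = proj₁ (proj₂ (proj₂ (blocker (col G′ w v′) w v′))) i∈Z
          ... | no w≢i = indep w∈ i∈ w≢i (∈-++⁺ʳ (proj₁ (blocker (col G′ w v) w v)) i∈Z)

          kind-clash : ∀ {i j k l} → i ≢ j → Kind i j → Covered ps i j → k ≢ l → k ∈ S → l ∈ S →
            col G′ i j ≢ pairColour k l
          kind-clash i≢j (old i∈ j∈) cv _ _ _ _ = covered⇒¬joined cv (old-joined i≢j i∈ j∈)
          kind-clash {k = k} {l} _ (new sm) _ k≢l k∈ l∈ eq =
            avoid k l k≢l (proj₂ (inS k∈)) (proj₂ (inS l∈)) (not-outside k∈ l∈ M≤v′) (trans (sym eq) (G′-same sm))
          kind-clash {k = k} {l} _ (spoke {w} w∈ sm) _ k≢l k∈ l∈ eq =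
            proj₂ (proj₂ (proj₂ (proj₂ (blocker (col G′ w v) w v)))) k l k≢l (free k∈ w∈) (free l∈ w∈)
              (not-outside k∈ l∈ M≤v) (trans (sym eq) (G′-same sm))
          kind-clash {k = k} {l} _ (spoke′ {w} w∈ sm) _ k≢l k∈ l∈ eq =
            proj₂ (proj₂ (proj₂ (proj₂ (blocker (col G′ w v′) w v′)))) k l k≢l (free′ k∈ w∈) (free′ l∈ w∈)
              (not-outside k∈ l∈ M≤v′) (trans (sym eq) (G′-same sm))

          clash : ∀ a b a′ b′ → H a b ≡ true → H a′ b′ ≡ true → Covered ps (φ a) (φ b) → Uncovered ps (φ a′) (φ b′) →
             col G′ (φ a) (φ b) ≢ pairColour (φ a′) (φ b′)
          clash a b a′ b′ hab hab′ cv unc =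
            let k∈ , l∈ = uncovered⇒∈S (kind a′ b′ hab′) unc
            in kind-clash (φ-≢ hab) (kind a b hab) cv (φ-≢ hab′) k∈ l∈

-- The order of the new edges

module Saturation (s K : ℕ) (M≤n : s + K ≤ n) {H : Adj h} (Hs : IsSimpleAdj H)
  {d : ℕ} {p x : Fin h} (hpx : H p x ≡ true) (degp : deg H p ≡ suc d) (d≤ : d ≤ s ∸ 1)
  (K≥ : h + 2 ≤ K) (K≥′ : indepBound 2 h + 1 ≤ K) where

  open Construction s K M≤n

  private
    -- A non-edge is listed with its smaller end first, and two clique vertices are always joined;
    -- so these are the non-edges between the clique and the outside.
    inner? : (e : Fin n × Fin n) → Dec (toℕ (proj₁ e) < M)
    inner? e = toℕ (proj₁ e) ℕ.<? M
    L = nonEdgeList (adj G)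
    first = filter inner? L
    es = first ++ filter (¬? ∘ inner?) L

  module _ (cs : List ℕ) (uniq : Unique cs) (len : length cs ≡ length es) (pre post : List (Entry n))
    (a b : Fin n) (c : ℕ) (zip≡ : zip es cs ≡ pre ++ ((a , b) , c) ∷ post) where

    private
      ps = pre ++ [ ((a , b) , c) ]

      es≡ : es ≡ map proj₁ pre ++ (a , b) ∷ map proj₁ post
      es≡ = trans (sym (map-proj₁-zip es cs len)) (trans (cong (map proj₁) zip≡) (map-++ proj₁ pre _))

      ps⊆zip : ps ⊆ zip es cs
      ps⊆zip q∈ with ∈-++⁻ pre q∈
      ... | inj₁ q∈pre = subst (_ ∈_) (sym zip≡) (∈-++⁺ˡ q∈pre)
      ... | inj₂ (here refl) = subst (_ ∈_) (sym zip≡) (∈-++⁺ʳ pre (here refl))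

      nonEdge : ∀ {q} → q ∈ ps → proj₁ (proj₁ q) F.< proj₂ (proj₁ q) × ¬ Joined (proj₁ (proj₁ q)) (proj₂ (proj₁ q))
      nonEdge q∈ with ∈-nonEdgeList⁻ (adj G) (∈-resp-↭ (filter-split-↭ inner? L)
                   (subst (_ ∈_) (map-proj₁-zip es cs len) (∈-map⁺ proj₁ (ps⊆zip q∈))))
      ... | lt , ne = lt , ne ∘ dec-true (joined? _ _)

      module St = Step Hs ps (λ q∈ q′∈ → zip-functional es uniq (ps⊆zip q∈) (ps⊆zip q′∈)) (proj₂ ∘ nonEdge)

      last∈ : ((a , b) , c) ∈ ps
      last∈ = ∈-++⁺ʳ pre (here refl)

      a<b : a F.< b
      a<b = proj₁ (nonEdge last∈)
      ¬joined : ¬ Joined a b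
      ¬joined = proj₂ (nonEdge last∈)
      a≢b : a ≢ b
      a≢b refl = <-irrefl refl a<b
      cov : Covered ps a b
      cov = _ , last∈ , inj₁ (refl , refl)

      -- The edge `a b` belongs to the second phase, so every non-edge of the first phase, such as
      -- `w v`, was added earlier.
      spoke-covered : ¬ toℕ a < M → ∀ v → M ≤ toℕ v → ∀ w → s ≤ toℕ w → toℕ w < M → Covered ps w v
      spoke-covered a≮M v M≤v w s≤w w<M
        with ∈-map⁻ proj₁ (++-prefix first es≡ (λ e∈ → a≮M (proj₂ (∈-filter⁻ inner? {xs = L} e∈))) w,v∈first)
        where
        w≁v : ¬ Joined w v
        w≁v (_ , inj₁ (inj₁ w<s)) = <⇒≱ w<s s≤w
        w≁v (_ , inj₁ (inj₂ v<s)) = <⇒≱ v<s (≤-trans (m≤m+n s K) M≤v)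
        w≁v (_ , inj₂ (_ , v<M)) = <⇒≱ v<M M≤v
        w,v∈first : (w , v) ∈ first
        w,v∈first = ∈-filter⁺ inner? (∈-nonEdgeList⁺ (adj G) (<-≤-trans w<M M≤v) (w≁v ∘ does-true⇒ (joined? w v))) w<M
      ... | q , q∈ , refl = q , ∈-++⁺ˡ q∈ , inj₁ (refl , refl)

    step : RainbowCopyWith H (addEdges G ps) (a , b)
    step with toℕ a ℕ.<? M
    ... | yes a<M = St.cliqueStep hpx degp d≤ K≥ a b
            (≮⇒≥ (λ a<s → ¬joined (a≢b , inj₁ (inj₁ a<s)))) a<M
            (≮⇒≥ (λ b<M → ¬joined (a≢b , inj₂ (a<M , b<M)))) cov
    ... | no a≮M = St.outerStep hpx K≥′ a b a≢b M≤a M≤b cov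
            (λ w s≤w w<M → spoke-covered a≮M a M≤a w s≤w w<M , spoke-covered a≮M b M≤b w s≤w w<M)
      where
      M≤a = ≮⇒≥ a≮M
      M≤b = ≤-trans M≤a (<⇒≤ a<b)

  saturated : WeaklyRainbowSat H G
  saturated = es , filter-split-↭ inner? L ,
    λ cs uniq len pre post e c zip≡ → step cs uniq len pre post (proj₁ e) (proj₂ e) c zip≡

-- The size of the clique, universal vertices included. The two lower bounds required of `K` are
-- added up, so that both hold.
core : ℕ → ℕ → ℕ
core h s = s + (h + 2 + (indepBound 2 h + 1))

weaklySaturatedGraph : {H : Adj h} → IsSimpleAdj H → ∀ {d p x} s → H p x ≡ true → deg H p ≡ suc d → d ≤ s ∸ 1 →
  ∀ n → core h s ≤ n →
  ∃[ G ] (IsSimpleCGraph {n} G × WeaklyRainbowSat H G × edgeCount (adj G) ≤ s * n + core h s * core h s)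
weaklySaturatedGraph {h} Hs s hpx degp d≤ n M≤n =
  G , G-simple , Saturation.saturated s K M≤n Hs hpx degp d≤ (m≤m+n (h + 2) _) (m≤n+m _ (h + 2)) , edgeCount≤
  where
  K = h + 2 + (indepBound 2 h + 1)
  open Construction s K M≤n

-- The minimum nonzero degree

minList-≤ : ∀ d ds {x} → x ∈ d ∷ ds → minList (d ∷ ds) ≤ x
minList-≤ d [] (here refl) = ≤-refl
minList-≤ d (b ∷ bs) (here refl) = ≤-trans (minList-≤ (d ⊓ b) bs (here refl)) (m⊓n≤m d b)
minList-≤ d (b ∷ bs) (there (here refl)) = ≤-trans (minList-≤ (d ⊓ b) bs (here refl)) (m⊓n≤n d b)
minList-≤ d (b ∷ bs) (there (there x∈)) = minList-≤ (d ⊓ b) bs (there x∈)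

minList-∈ : ∀ d ds → minList (d ∷ ds) ∈ d ∷ ds
minList-∈ d [] = here refl
minList-∈ d (b ∷ bs) with minList-∈ (d ⊓ b) bs | ⊓-sel d b
... | here eq | inj₁ eq′ = here (trans eq eq′)
... | here eq | inj₂ eq′ = there (here (trans eq eq′))
... | there x∈ | _ = there (there x∈)

module _ (H : Adj h) where

  private
    nonzero? = λ k → ¬? (k ℕ.≟ 0)
    degrees = filter nonzero? (map (deg H) (allFin h))

  deg≢0 : ∀ {x y} → H x y ≡ true → deg H x ≢ 0
  deg≢0 {x} hxy eq with neighbours H x | ∈-neighbours⁺ H hxy
  deg≢0 hxy () | _ ∷ _ | _

  deg∈degrees : ∀ {x y} → H x y ≡ true → deg H x ∈ degrees
  deg∈degrees hxy = ∈-filter⁺ nonzero? (∈-map⁺ (deg H) (∈-allFin _)) (deg≢0 hxy)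

  δ′≤deg : ∀ x y → H x y ≡ true → δ′ H ≤ deg H x
  δ′≤deg x y hxy with degrees | deg∈degrees hxy
  ... | d ∷ ds | x∈ = minList-≤ d ds x∈

  -- An edge makes the list of nonzero degrees nonempty, so `minList` returns one of its members and
  -- not the default 0.
  δ′-attained : HasEdge H → ∃[ p ] (deg H p ≡ δ′ H × δ′ H ≢ 0)
  δ′-attained (x , y , hxy)
    with ∈-filter⁻ nonzero? {xs = map (deg H) (allFin h)} (min∈ degrees (deg∈degrees hxy))
    where
    min∈ : ∀ ds {d} → d ∈ ds → minList ds ∈ ds
    min∈ (d ∷ ds) _ = minList-∈ d ds
  ... | δ∈ , δ≢0 with ∈-map⁻ (deg H) δ∈
  ...   | p , _ , eq = p , sym eq , δ≢0

  neighbour : ∀ p → deg H p ≢ 0 → ∃[ x ] (H p x ≡ true)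
  neighbour p ne with neighbours H p in eq
  ... | [] = contradiction refl ne
  ... | x ∷ _ = x , ∈-neighbours⁻ H (subst (x ∈_) (sym eq) (here refl))

-- From graphs to the asymptotic bounds

module _ {H : Adj h} (r : ℕ → ℕ) (rwsat : ∀ n → IsRwsat H n (r n)) where

  -- The existence of a weakly saturated graph excludes the alternative with the default value
  -- `n C 2`, so minimality of `r n` applies.
  rwsat≤ : ∀ {n m} → ∃[ G ] (IsSimpleCGraph {n} G × WeaklyRainbowSat H G × edgeCount (adj G) ≤ m) → r n ≤ m
  rwsat≤ {n} (G , simple , sat , le) with rwsat n
  ... | inj₁ (_ , _ , _ , _ , minimal) = ≤-trans (minimal G simple sat) le
  ... | inj₂ (none , _) = contradiction sat (none G simple)

  rwsat-attained : ∀ {n m} → ∃[ G ] (IsSimpleCGraph {n} G × WeaklyRainbowSat H G × edgeCount (adj G) ≤ m) →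
    ∃[ G ] (IsSimpleCGraph {n} G × WeaklyRainbowSat H G × edgeCount (adj G) ≡ r n)
  rwsat-attained {n} (G , simple , sat , _) with rwsat n
  ... | inj₁ (G₀ , simple₀ , sat₀ , eq , _) = G₀ , simple₀ , sat₀ , eq
  ... | inj₂ (none , _) = contradiction sat (none G simple)

-- The bounds on the limit with denominators cleared: for every `k` and all large `n`, the quotient
-- `r n / n` is at most `1/k` in the pendant case, and otherwise lies between `δ′ H / 2 - 1/k` and
-- `δ′ H + 1/k`.
theorem1p3 : (h : ℕ) (H : Adj h) → IsSimpleAdj H → HasEdge H →
    (r : ℕ → ℕ) → (∀ n → IsRwsat H n (r n)) →
    (HasPendantEdge H →
    ∀ k → 1 ≤ k → ∃[ N ] (∀ n → N ≤ n → k * r n ≤ n))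
    × (¬ HasPendantEdge H →
    (∀ k → 1 ≤ k → ∃[ N ] (∀ n → N ≤ n → k * δ′ H * n ≤ 2 * k * r n + 2 * n))
    × (∀ k → 1 ≤ k → ∃[ N ] (∀ n → N ≤ n → k * r n ≤ k * δ′ H * n + n)))
theorem1p3 h H Hs edge r rwsat = pendant , λ ¬pendant → lower ¬pendant , upper ¬pendant
  where
  open ≤-Reasoning

  leaf : HasPendantEdge H → ∃[ p ] ∃[ x ] (H p x ≡ true × deg H p ≡ 1)
  leaf (x , y , hxy , inj₁ eq) = x , y , hxy , eq
  leaf (x , y , hxy , inj₂ eq) = y , x , trans (proj₁ Hs y x) hxy , eq

  pendant : HasPendantEdge H → ∀ k → 1 ≤ k → ∃[ N ] (∀ n → N ≤ n → k * r n ≤ n)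
  pendant hp k _ with leaf hp
  -- With `s = 0` the edge count is at most the constant `C`. The threshold makes room for the
  -- clique and ensures `k * C ≤ n`.
  ... | p , x , hpx , degp = core h 0 + k * C , λ n N≤n → begin
      k * r n  ≤⟨ *-monoʳ-≤ k (rwsat≤ r rwsat (weaklySaturatedGraph Hs 0 hpx degp z≤n n (m+n≤o⇒m≤o _ N≤n))) ⟩
      k * C    ≤⟨ m+n≤o⇒n≤o (core h 0) N≤n ⟩
      n ∎
    where
    C = core h 0 * core h 0

  δ = δ′ H

  minDegreeVertex : ¬ HasPendantEdge H → 2 ≤ δ × ∃[ p ] ∃[ x ] ∃[ d ] (H p x ≡ true × deg H p ≡ suc d × δ ≡ suc d)
  minDegreeVertex ¬pendant with δ′-attained H edge
  ... | p , degp , δ≢0 with neighbour H p (δ≢0 ∘ trans (sym degp))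
  ...   | x , hpx with δ′ H
  ...     | zero = contradiction refl δ≢0
  -- A vertex of degree 1 would be the end of a pendant edge.
  ...     | suc zero = contradiction (p , x , hpx , inj₁ degp) ¬pendant
  ...     | suc (suc d) = s≤s (s≤s z≤n) , p , x , suc d , hpx , degp , refl

  saturatedGraph : ¬ HasPendantEdge H → ∀ n → core h δ ≤ n →
    ∃[ G ] (IsSimpleCGraph {n} G × WeaklyRainbowSat H G × edgeCount (adj G) ≤ δ * n + core h δ * core h δ)
  saturatedGraph ¬pendant n N≤n with minDegreeVertex ¬pendant
  ... | _ , p , x , d , hpx , degp , δ≡ =
    weaklySaturatedGraph Hs δ hpx degp (≤-reflexive (cong (_∸ 1) (sym δ≡))) n N≤n

  upper : ¬ HasPendantEdge H → ∀ k → 1 ≤ k → ∃[ N ] (∀ n → N ≤ n → k * r n ≤ k * δ * n + n)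
  upper ¬pendant k _ = core h δ + k * C , λ n N≤n → begin
      k * r n            ≤⟨ *-monoʳ-≤ k (rwsat≤ r rwsat (saturatedGraph ¬pendant n (m+n≤o⇒m≤o _ N≤n))) ⟩
      k * (δ * n + C)    ≡⟨ *-distribˡ-+ k (δ * n) C ⟩
      k * (δ * n) + k * C ≡⟨ cong (_+ k * C) (sym (*-assoc k δ n)) ⟩
      k * δ * n + k * C  ≤⟨ +-monoʳ-≤ (k * δ * n) (m+n≤o⇒n≤o (core h δ) N≤n) ⟩
      k * δ * n + n ∎
    where
    C = core h δ * core h δ

  δ<core : δ < core h δ
  δ<core = ≤-trans (≤-reflexive (+-comm 1 δ)) (+-monoʳ-≤ δ
    (≤-trans (m≤n+m 1 (indepBound 2 h)) (m≤n+m (indepBound 2 h + 1) (h + 2))))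

  lower : ¬ HasPendantEdge H → ∀ k → 1 ≤ k → ∃[ N ] (∀ n → N ≤ n → k * δ * n ≤ 2 * k * r n + 2 * n)
  lower ¬pendant k _ = core h δ , bound
    where
    bound : ∀ n → core h δ ≤ n → k * δ * n ≤ 2 * k * r n + 2 * n
    bound n N≤n with rwsat-attained r rwsat (saturatedGraph ¬pendant n N≤n)
    ... | G , simple , sat , eq = begin
      k * δ * n                                      ≡⟨ arrange k δ n ⟩
      k * (n * δ)                                    ≤⟨ *-monoʳ-≤ k (minDegree⇒edgeCount (adj G) (proj₁ simple) δ
          (MinDegree.δ≤deg Hs simple sat δ (proj₁ (minDegreeVertex ¬pendant)) (<-≤-trans δ<core N≤n) (δ′≤deg H))) ⟩
      k * (edgeCount (adj G) + edgeCount (adj G))    ≡⟨ cong (λ m → k * (m + m)) eq ⟩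
      k * (r n + r n)                                ≡⟨ double k (r n) ⟩
      2 * k * r n                                    ≤⟨ m≤m+n _ _ ⟩
      2 * k * r n + 2 * n ∎
      where
      arrange : ∀ k d n → k * d * n ≡ k * (n * d)
      arrange = solve-∀
      double : ∀ k m → k * (m + m) ≡ 2 * k * m
      double = solve-∀
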